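{- Let $G$ be a $3$-tree. Then $\tau(G)\leq \frac{9}{5}\,\nu(G)+\frac{1}{5}$.
   Context: A $3$-tree is a graph obtained from $K_3$ by successively choosing a triangle in the current graph and adding a new vertex adjacent to its three vertices (any finite number of times, possibly zero). $\tau(G)$ is the minimum size of a set of edges of $G$ whose removal leaves a triangle-free graph, and $\nu(G)$ is the maximum number of pairwise edge-disjoint triangles in $G$. -}

module Defs where

open import Data.Empty using (⊥)
open import Data.Fin.Base using (Fin; zero; suc)
open import Data.Fin.Permutation using (Permutation′; _⟨$⟩ʳ_)
open import Data.Fin.Properties using (_≟_; _<?_; all?)
open import Data.List.Base using (List; []; _∷_; _++_; map; filter; length; allFin; cartesianProduct)
open import Data.List.Extrema.Nat using (min; max)
open import Data.List.Relation.Binary.Disjoint.Propositional using (Disjoint)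
open import Data.List.Relation.Unary.AllPairs using (allPairs?)
open import Data.Nat.Base using (ℕ; suc)
open import Data.Product.Base using (_×_; _,_; ∃)
open import Data.Product.Properties using (≡-dec)
open import Data.Sum.Base using (_⊎_)
open import Function.Bundles using (_⇔_)
open import Level using (0ℓ)
open import Relation.Binary.Core using (Rel)
open import Relation.Binary.Definitions using (Decidable; DecidableEquality; Irreflexive; Symmetric)
open import Relation.Binary.PropositionalEquality.Core using (_≡_; _≢_; refl; ≢-sym)
open import Relation.Nullary.Decidable using (Dec; no; _×-dec_; _⊎-dec_; ¬?)
open import Relation.Nullary.Negation using (¬_)
import Data.List.Membership.DecPropositional as Membership
import Data.List.Relation.Binary.Disjoint.DecPropositional as DecDisjoint

infix 4 _≅_

record Graph (n : ℕ) : Set₁ where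
  field
    Adj    : Rel (Fin n) 0ℓ
    adj?   : Decidable Adj
    irrefl : Irreflexive _≡_ Adj
    symm   : Symmetric Adj

open Graph public

_≅_ : ∀ {n} → Graph n → Graph n → Set
_≅_ {n} G H = ∃ λ (π : Permutation′ n) → ∀ i j → Adj G i j ⇔ Adj H (π ⟨$⟩ʳ i) (π ⟨$⟩ʳ j)

IsTriangle : ∀ {n} → Graph n → Fin n × Fin n × Fin n → Set
IsTriangle G (i , j , k) = Adj G i j × Adj G i k × Adj G j k

isTriangle? : ∀ {n} (G : Graph n) t → Dec (IsTriangle G t)
isTriangle? G (i , j , k) = adj? G i j ×-dec adj? G i k ×-dec adj? G j k

complete : ∀ n → Graph n
complete n = record
  { Adj    = _≢_
  ; adj?   = λ i j → ¬? (i ≟ j)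
  ; irrefl = λ i≡j i≢j → i≢j i≡j
  ; symm   = ≢-sym
  }

-- `stack G a b c` adds a vertex adjacent to exactly a, b and c.
-- The new vertex is `zero`; the old vertices are shifted by `suc`.
module _ {n : ℕ} (G : Graph n) (a b c : Fin n) where

  Chosen : Fin n → Set
  Chosen i = i ≡ a ⊎ i ≡ b ⊎ i ≡ c

  chosen? : ∀ i → Dec (Chosen i)
  chosen? i = (i ≟ a) ⊎-dec (i ≟ b) ⊎-dec (i ≟ c)

  StackAdj : Rel (Fin (suc n)) 0ℓ
  StackAdj zero    zero    = ⊥
  StackAdj zero    (suc j) = Chosen j
  StackAdj (suc i) zero    = Chosen i
  StackAdj (suc i) (suc j) = Adj G i j

  stackAdj? : Decidable StackAdj
  stackAdj? zero    zero    = no λ ()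
  stackAdj? zero    (suc j) = chosen? j
  stackAdj? (suc i) zero    = chosen? i
  stackAdj? (suc i) (suc j) = adj? G i j

  stack-irrefl : Irreflexive _≡_ StackAdj
  stack-irrefl {suc i} refl = irrefl G refl

  stack-symm : Symmetric StackAdj
  stack-symm {zero}  {suc j} p = p
  stack-symm {suc i} {zero}  p = p
  stack-symm {suc i} {suc j} p = symm G p

  stack : Graph (suc n)
  stack = record
    { Adj    = StackAdj
    ; adj?   = stackAdj?
    ; irrefl = stack-irrefl
    ; symm   = λ {i} {j} → stack-symm {i} {j}
    }

data Stacked : ∀ {n} → Graph n → Set₁ where
  base : Stacked (complete 3)
  step : ∀ {n} {G : Graph n} → Stacked G →
         ∀ a b c → IsTriangle G (a , b , c) → Stacked (stack G a b c)

-- The vertices of a 3-tree may be numbered in any order.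
Is3Tree : ∀ {n} → Graph n → Set₁
Is3Tree {n} G = ∃ λ (H : Graph n) → Stacked H × G ≅ H

-- Edges and triangles are listed once each, with increasing vertices.
edges : ∀ {n} → Graph n → List (Fin n × Fin n)
edges {n} G = filter (λ (i , j) → (i <? j) ×-dec adj? G i j)
                     (cartesianProduct (allFin n) (allFin n))

triangles : ∀ {n} → Graph n → List (Fin n × Fin n × Fin n)
triangles {n} G =
  filter (λ (i , j , k) → (i <? j) ×-dec (j <? k) ×-dec isTriangle? G (i , j , k))
         (cartesianProduct (allFin n) (cartesianProduct (allFin n) (allFin n)))

module _ {n : ℕ} where

  _≟ₑ_ : DecidableEquality (Fin n × Fin n)
  _≟ₑ_ = ≡-dec _≟_ _≟_

  open Membership _≟ₑ_ using (_∉_; _∉?_)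
  open DecDisjoint _≟ₑ_ using (disjoint?)

  infixl 6 _−_

  _−_ : Graph n → List (Fin n × Fin n) → Graph n
  G − F = record
    { Adj    = λ i j → Adj G i j × (i , j) ∉ F × (j , i) ∉ F
    ; adj?   = λ i j → adj? G i j ×-dec ((i , j) ∉? F) ×-dec ((j , i) ∉? F)
    ; irrefl = λ i≡j (p , _) → irrefl G i≡j p
    ; symm   = λ (p , q , r) → symm G p , r , q
    }

  TriangleFree : Graph n → Set
  TriangleFree G = ∀ i j k → ¬ IsTriangle G (i , j , k)

  triangleFree? : (G : Graph n) → Dec (TriangleFree G)
  triangleFree? G = all? λ i → all? λ j → all? λ k → ¬? (isTriangle? G (i , j , k))

  triangleEdges : Fin n × Fin n × Fin n → List (Fin n × Fin n)
  triangleEdges (i , j , k) = (i , j) ∷ (i , k) ∷ (j , k) ∷ []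

  -- Meaningful for triples with increasing entries, as in `triangles`, whose
  -- edges are then increasing pairs.
  EdgeDisjoint : Rel (Fin n × Fin n × Fin n) 0ℓ
  EdgeDisjoint s t = Disjoint (triangleEdges s) (triangleEdges t)

  edgeDisjoint? : Decidable EdgeDisjoint
  edgeDisjoint? s t = disjoint? (triangleEdges s) (triangleEdges t)

-- For a list without repetitions, these are its subsets.
sublists : ∀ {A : Set} → List A → List (List A)
sublists []       = [] ∷ []
sublists (x ∷ xs) = map (x ∷_) (sublists xs) ++ sublists xs

-- The first argument of `min` is harmless: deleting every edge leaves a
-- triangle-free graph, so the length of `edges G` is among the candidates.
τ : ∀ {n} → Graph n → ℕ
τ G = min (length (edges G))
          (map length (filter (λ F → triangleFree? (G − F)) (sublists (edges G))))

-- The 0 is the size of the empty family of triangles.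
ν : ∀ {n} → Graph n → ℕ
ν G = max 0 (map length (filter (allPairs? edgeDisjoint?) (sublists (triangles G))))

{-# OPTIONS --safe #-}
{- The vertices added to the first triangle form a rooted forest: the children of a
vertex u added to a b c are the vertices added to u b c, u a c or u a b. Going up from
the leaves, every node is made into a leaf (no remaining children), a chain (a single
remaining child, which is a leaf), or is removed together with its descendants. What has
been removed is paid for by T deleted edges and k disjoint triangles.

A leaf on a b c contributes one more triangle using any one of the edges ab, ac, bc. A
chain contributes one triangle without using these edges, and a second one using one of
at least two of them. On the other side, once a b c is hit, a leaf costs one edge and a
chain two; if ab, ac and bc are all deleted, a leaf is free and a chain costs one. A
node u whose children are ℓ leaves and m chains, and which is neither a leaf nor a chain,
can be removed by deleting t edges against j + m triangles, where 5t ≤ 9(j + m):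
  ℓ = 0:                                 j = 1 and t = min(1 + 2m, 5 + m);
  1 ≤ ℓ ≤ 2, or all leaves on one face: j = 2 and t = min(3 + 2m, 5 + m);
  otherwise:                             j = 3 and t = 5 + m.
The same comparison at the initial triangle loses the additive 1/5. -}
module Submission where

open import Defs
open import Data.Nat.Base as ℕ using (ℕ)
open import Data.Nat.Tactic.RingSolver using (solve-∀)
open import Relation.Binary.PropositionalEquality
  using (_≡_; _≢_; refl; sym; trans; cong; cong₂; subst; subst₂)

module TreeBound where

  open import Data.Empty using (⊥-elim)
  open import Data.Fin.Base as Fin using (Fin; zero; suc)
  open import Data.Fin.Permutation using (_⟨$⟩ʳ_; _⟨$⟩ˡ_; inverseʳ; inverseˡ)
  open import Data.Fin.Properties as Fin using (_≟_; _<?_; suc-injective)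
  open import Data.List.Base using (List; []; _∷_; _++_; length; map; filter)
  open import Data.List.Extrema.Nat using (min≤xs; xs≤max)
  import Data.List.Membership.DecPropositional as DecMembership
  open import Data.List.Membership.Propositional using (_∈_)
  open import Data.List.Membership.Propositional.Properties
    using (∈-++⁺ˡ; ∈-++⁺ʳ; ∈-++⁻; ∈-map⁺; ∈-filter⁺; ∈-filter⁻; ∈-cartesianProduct⁺; ∈-allFin; ∈-∃++)
  open import Data.List.Properties using (length-++; length-map; ++-assoc; ++-identityʳ)
  open import Data.List.Relation.Binary.Subset.Propositional using (_⊆_)
  open import Data.List.Relation.Unary.All as All using (All; []; _∷_)
  open import Data.List.Relation.Unary.All.Properties using (++⁺)
  open import Data.List.Relation.Unary.AllPairs as AllPairs using (AllPairs; []; _∷_; allPairs?)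
  open import Data.List.Relation.Unary.Any using (here; there)
  open import Data.List.Relation.Unary.Unique.Propositional using (Unique)
  import Data.List.Relation.Unary.Unique.Propositional.Properties as Unique
  open import Data.Nat.Base using (zero; suc; _+_; _*_; _≤_; z≤n; s≤s; s≤s⁻¹)
  open import Data.Nat.Properties hiding (_≟_; _<?_; suc-injective; <-cmp; <-asym)
  open import Data.Product.Base using (_×_; _,_; ∃; ∃₂; proj₁; proj₂)
  open import Data.Product.Properties using (≡-dec)
  open import Data.Sum.Base using (_⊎_; inj₁; inj₂) renaming (swap to ⊎-swap; map to ⊎-map)
  open import Function.Base using (_∘_; case_of_)
  open import Function.Bundles using (module Equivalence)
  open import Relation.Binary.Definitions using (Symmetric; tri<; tri≈; tri>)
  open import Relation.Nullary.Decidable using (Dec; yes; no; _×-dec_; _⊎-dec_; True; toWitness)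
  open import Relation.Nullary.Negation using (¬_)
  open import Relation.Unary using (Decidable)

  -- Indicators, sides of a triangle and small arithmetic.

  ⟦_⟧ : ∀ {P : Set} → Dec P → ℕ
  ⟦ yes _ ⟧ = 1
  ⟦ no  _ ⟧ = 0

  data Side : Set where
    A B C : Side

  multiplicity : List Side → Side → ℕ
  multiplicity []      _ = 0
  multiplicity (A ∷ L) A = suc (multiplicity L A)
  multiplicity (B ∷ L) B = suc (multiplicity L B)
  multiplicity (C ∷ L) C = suc (multiplicity L C)
  multiplicity (_ ∷ L) s = multiplicity L s

  Distinct : List Side → Set
  Distinct L = multiplicity L A ≤ 1 × multiplicity L B ≤ 1 × multiplicity L C ≤ 1

  distinct? : ∀ L → Dec (Distinct L)
  distinct? L = multiplicity L A ≤? 1 ×-dec multiplicity L B ≤? 1 ×-dec multiplicity L C ≤? 1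

  two-distinct : ∀ s t → s ≢ t → Distinct (s ∷ t ∷ [])
  two-distinct A A s≢t = ⊥-elim (s≢t refl)
  two-distinct A B _ = s≤s z≤n , s≤s z≤n , z≤n
  two-distinct A C _ = s≤s z≤n , z≤n , s≤s z≤n
  two-distinct B A _ = s≤s z≤n , s≤s z≤n , z≤n
  two-distinct B B s≢t = ⊥-elim (s≢t refl)
  two-distinct B C _ = z≤n , s≤s z≤n , s≤s z≤n
  two-distinct C A _ = s≤s z≤n , z≤n , s≤s z≤n
  two-distinct C B _ = z≤n , s≤s z≤n , s≤s z≤n
  two-distinct C C s≢t = ⊥-elim (s≢t refl)

  third : ∀ (s t : Side) → ∃ λ r → r ≢ s × r ≢ t
  third A A = B , (λ ()) , λ ()
  third A B = C , (λ ()) , λ ()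
  third A C = B , (λ ()) , λ ()
  third B A = C , (λ ()) , λ ()
  third B B = A , (λ ()) , λ ()
  third B C = A , (λ ()) , λ ()
  third C A = B , (λ ()) , λ ()
  third C B = A , (λ ()) , λ ()
  third C C = A , (λ ()) , λ ()

  -- At most one of two different sides is `d`. This brings what a chain offers, every side but `d`,
  -- into the form of `Offers.some`.
  avoid : ∀ d {X : Side → Set} → (∀ s → s ≢ d → X s) →
          ∀ s t → s ≢ t → X s ⊎ X t
  avoid A f A A s≢t = ⊥-elim (s≢t refl)
  avoid A f A B _   = inj₂ (f B λ ())
  avoid A f A C _   = inj₂ (f C λ ())
  avoid A f B t _   = inj₁ (f B λ ())
  avoid A f C t _   = inj₁ (f C λ ())
  avoid B f B B s≢t = ⊥-elim (s≢t refl)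
  avoid B f B A _   = inj₂ (f A λ ())
  avoid B f B C _   = inj₂ (f C λ ())
  avoid B f A t _   = inj₁ (f A λ ())
  avoid B f C t _   = inj₁ (f C λ ())
  avoid C f C C s≢t = ⊥-elim (s≢t refl)
  avoid C f C A _   = inj₂ (f A λ ())
  avoid C f C B _   = inj₂ (f B λ ())
  avoid C f A t _   = inj₁ (f A λ ())
  avoid C f B t _   = inj₁ (f B λ ())

  -- Tells a lone leaf from all other cases: `l` counts the leaves beyond the first on the only face
  -- with leaves, `m` the chains there, `m′` and `m″` the chains on the other two faces.
  crowded? : ∀ l m m′ m″ → (l + m ≡ 0 × m′ ≡ 0 × m″ ≡ 0) ⊎ (1 ≤ l + m ⊎ 1 ≤ m′ ⊎ 1 ≤ m″)
  crowded? (suc l) m m′ m″ = inj₂ (inj₁ (s≤s z≤n))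
  crowded? zero (suc m) m′ m″ = inj₂ (inj₁ (s≤s z≤n))
  crowded? zero zero (suc m′) m″ = inj₂ (inj₂ (inj₁ (s≤s z≤n)))
  crowded? zero zero zero (suc m″) = inj₂ (inj₂ (inj₂ (s≤s z≤n)))
  crowded? zero zero zero zero = inj₁ (refl , refl , refl)

  has : ∀ {l x} → l ≡ suc x → 1 ≤ l
  has refl = s≤s z≤n

  has-two : ∀ {l x m} → l ≡ suc x → 1 ≤ x + m → 2 ≤ l + m
  has-two refl = s≤s

  has-chain : ∀ l {m} → 1 ≤ m → 1 ≤ l + m
  has-chain l h = ≤-trans h (m≤n+m _ l)

  one-leaf : ∀ {x l m} → l ≡ suc x → x + m ≡ 0 → l ≡ 1 × m ≡ 0
  one-leaf {zero} refl refl = refl , refl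

  -- When all leaves lie on one face, three edges delete that face entirely: its leaves become free
  -- and its `m₁` chains cost one each. The leaf counts `x` and `y` of the other faces vanish, and
  -- counting all chains at two leaves a slack of `m₁`.
  one-sided : ∀ t₁ t₂ t₃ m₁ m₂ m₃ x y → x + y ≤ 0 →
    3 + ((t₁ + m₁) + (t₂ + (x + 2 * m₂)) + (t₃ + (y + 2 * m₃)))
    ≤ (3 + 2 * (m₁ + m₂ + m₃)) + (t₁ + t₂ + t₃)
  one-sided t₁ t₂ t₃ m₁ m₂ m₃ zero zero _ = ≤-trans (m≤m+n _ m₁) (≤-reflexive (lemma t₁ t₂ t₃ m₁ m₂ m₃))
    where
    lemma : ∀ t₁ t₂ t₃ m₁ m₂ m₃ →
      3 + ((t₁ + m₁) + (t₂ + (0 + 2 * m₂)) + (t₃ + (0 + 2 * m₃))) + m₁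
      ≡ (3 + 2 * (m₁ + m₂ + m₃)) + (t₁ + t₂ + t₃)
    lemma = solve-∀

  pattern #0 = here refl
  pattern #1 = there #0
  pattern #2 = there #1
  pattern #3 = there #2
  pattern #4 = there #3

  -- Edges counted with multiplicity.

  module _ {n : ℕ} where

    V : Set
    V = Fin n

    -- An edge supply: how many copies of the unordered edge {u , w} are available.
    Supply : Set
    Supply = V → V → ℕ

    infixl 6 _⊕_
    infix  4 _≼_

    _⊕_ : Supply → Supply → Supply
    (R ⊕ S) u w = R u w + S u w

    ∅ : Supply
    ∅ _ _ = 0

    _≼_ : Supply → Supply → Set
    R ≼ S = ∀ u w → R u w ≤ S u w

    SameEdge : V → V → V → V → Set
    SameEdge x y u w = (x ≡ u × y ≡ w) ⊎ (x ≡ w × y ≡ u)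

    sameEdge? : ∀ x y u w → Dec (SameEdge x y u w)
    sameEdge? x y u w = (x ≟ u ×-dec y ≟ w) ⊎-dec (x ≟ w ×-dec y ≟ u)

    δ : V → V → Supply
    δ x y u w = ⟦ sameEdge? x y u w ⟧

    load : List (V × V × V) → Supply
    load []                = ∅
    load ((x , y , z) ∷ P) = δ x y ⊕ δ x z ⊕ δ y z ⊕ load P

    load-++ : ∀ P Q u w → load (P ++ Q) u w ≡ load P u w + load Q u w
    load-++ []                Q u w = refl
    load-++ ((x , y , z) ∷ P) Q u w =
      trans (cong ((δ x y u w + δ x z u w + δ y z u w) +_) (load-++ P Q u w))
            (sym (+-assoc (δ x y u w + δ x z u w + δ y z u w) (load P u w) (load Q u w)))

    demand : (Side → Supply) → List Side → Supply
    demand P []      = ∅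
    demand P (s ∷ L) = P s ⊕ demand P L

    demand-++ : ∀ P L M u w → demand P (L ++ M) u w ≡ demand P L u w + demand P M u w
    demand-++ P []      M u w = refl
    demand-++ P (s ∷ L) M u w =
      trans (cong (P s u w +_) (demand-++ P L M u w)) (sym (+-assoc (P s u w) _ _))

    all-sides : (Side → Supply) → Supply
    all-sides P = P A ⊕ P B ⊕ P C

    demand-multiplicity : ∀ P L u w → demand P L u w ≡
      multiplicity L A * P A u w + multiplicity L B * P B u w + multiplicity L C * P C u w
    demand-multiplicity P []      u w = refl
    demand-multiplicity P (A ∷ L) u w = trans (cong (P A u w +_) (demand-multiplicity P L u w))
      (lemma (P A u w) (multiplicity L A * P A u w) (multiplicity L B * P B u w) (multiplicity L C * P C u w))
      where
      lemma : ∀ p a b c → p + (a + b + c) ≡ p + a + b + c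
      lemma = solve-∀
    demand-multiplicity P (B ∷ L) u w = trans (cong (P B u w +_) (demand-multiplicity P L u w))
      (lemma (P B u w) (multiplicity L A * P A u w) (multiplicity L B * P B u w) (multiplicity L C * P C u w))
      where
      lemma : ∀ p a b c → p + (a + b + c) ≡ a + (p + b) + c
      lemma = solve-∀
    demand-multiplicity P (C ∷ L) u w = trans (cong (P C u w +_) (demand-multiplicity P L u w))
      (lemma (P C u w) (multiplicity L A * P A u w) (multiplicity L B * P B u w) (multiplicity L C * P C u w))
      where
      lemma : ∀ p a b c → p + (a + b + c) ≡ a + b + (p + c)
      lemma = solve-∀

    -- Regrouped by sides, the demand has coefficients at most one.
    demand-distinct : ∀ P L → Distinct L → demand P L ≼ all-sides P
    demand-distinct P L (a , b , c) u w =
      ≤-trans (≤-reflexive (demand-multiplicity P L u w))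
              (+-mono-≤ (+-mono-≤ (once a) (once b)) (once c))
      where
      once : ∀ {k x} → k ≤ 1 → k * x ≤ x
      once {k} {x} k≤1 = ≤-trans (*-monoˡ-≤ x k≤1) (≤-reflexive (*-identityˡ x))

    -- Packings of triangles, and what leaves and chains add to them.

    module Packings (G : Graph n) where

      -- Edge-disjointness is replaced by a bound on edge multiplicities, so packings of different
      -- branches unite without comparing their edges. It becomes real disjointness when `R` is at
      -- most one everywhere.
      record Pack (k : ℕ) (R : Supply) : Set where
        constructor pack
        field
          family : List (V × V × V)
          size   : k ≤ length family
          valid  : All (IsTriangle G) family
          fits   : load family ≼ R

      nothing : Pack 0 ∅
      nothing = pack [] z≤n [] λ _ _ → z≤n

      weaken : ∀ {k l R S} → l ≤ k → R ≼ S → Pack k R → Pack l S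
      weaken l≤k R≼S (pack P s v f) = pack P (≤-trans l≤k s) v λ u w → ≤-trans (f u w) (R≼S u w)

      adapt : ∀ {k R S} → (∀ u w → R u w ≡ S u w) → Pack k R → Pack k S
      adapt eq = weaken ≤-refl λ u w → ≤-reflexive (eq u w)

      union : ∀ {k l R S} → Pack k R → Pack l S → Pack (k + l) (R ⊕ S)
      union (pack P s v f) (pack Q t v′ g) = pack (P ++ Q)
        (≤-trans (+-mono-≤ s t) (≤-reflexive (sym (length-++ P))))
        (++⁺ v v′)
        λ u w → ≤-trans (≤-reflexive (load-++ P Q u w)) (+-mono-≤ (f u w) (g u w))

      single : ∀ {x y z} → IsTriangle G (x , y , z) → Pack 1 (δ x y ⊕ δ x z ⊕ δ y z)
      single xyz = pack (_ ∷ []) ≤-refl (xyz ∷ []) λ u w → ≤-reflexive (+-identityʳ _)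

      -- One extra triangle for each entry of L, at the price of the edge on that side.
      record Extra (P : Side → Supply) (k : ℕ) (R : Supply) (L : List Side) : Set where
        constructor extra
        field packing : Pack (length L + k) (demand P L ⊕ R)

      open Extra

      join : ∀ {P k l R S L M} → Extra P k R L → Extra P l S M → Extra P (k + l) (R ⊕ S) (L ++ M)
      join {P} {k} {l} {R} {S} {L} {M} (extra p) (extra q) = extra
        (weaken (≤-reflexive (trans (cong (_+ (k + l)) (length-++ L)) (shuffle (length L) (length M) k l)))
                (λ u w → ≤-reflexive (sym (trans (cong (_+ (R u w + S u w)) (demand-++ P L M u w))
                                                 (shuffle (demand P L u w) (demand P M u w) (R u w) (S u w)))))
                (union p q))
        where
        shuffle : ∀ a b c d → a + b + (c + d) ≡ a + c + (b + d)
        shuffle = solve-∀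

      swap : ∀ {P k R s t} → Extra P k R (s ∷ t ∷ []) → Extra P k R (t ∷ s ∷ [])
      swap {P} {k} {R} {s} {t} (extra p) = extra (adapt (λ u w → exchange (P s u w) (P t u w) (R u w)) p)
        where
        exchange : ∀ a b c → a + (b + 0) + c ≡ b + (a + 0) + c
        exchange = solve-∀

      within : ∀ {P k R L} → Distinct L → Extra P k R L → Pack (length L + k) (all-sides P ⊕ R)
      within {P} {L = L} d (extra p) =
        weaken ≤-refl (λ u w → +-monoˡ-≤ _ (demand-distinct P L d u w)) p

      -- A leaf serves every side, a chain refuses at most one. Two chains may refuse the same side,
      -- so `two` needs a leaf to serve prescribed sides, whereas `pair` chooses its sides. These
      -- claims are closed under `merge`.
      record Offers (P : Side → Supply) (k : ℕ) (R : Supply) (ℓ m : ℕ) : Set where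
        field
          none : Extra P k R []
          leaf : 1 ≤ ℓ → ∀ s → Extra P k R (s ∷ [])
          some : 1 ≤ ℓ + m → ∀ s t → s ≢ t → Extra P k R (s ∷ []) ⊎ Extra P k R (t ∷ [])
          two  : 1 ≤ ℓ → 2 ≤ ℓ + m → ∀ s t → s ≢ t → Extra P k R (s ∷ t ∷ [])
          pair : 2 ≤ ℓ + m → ∃₂ λ s t → s ≢ t × Extra P k R (s ∷ t ∷ [])

      open Offers

      merge-leaf : ∀ {P k l R S ℓ m ℓ′ m′} → Offers P k R ℓ m → Offers P l S ℓ′ m′ →
                   1 ≤ ℓ + ℓ′ → ∀ s → Extra P (k + l) (R ⊕ S) (s ∷ [])
      merge-leaf {ℓ = zero}  o o′ h s = join (none o) (leaf o′ h s)
      merge-leaf {ℓ = suc _} o o′ h s = join (leaf o (s≤s z≤n) s) (none o′)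

      merge-some : ∀ {P k l R S ℓ m ℓ′ m′} → Offers P k R ℓ m → Offers P l S ℓ′ m′ →
                   1 ≤ (ℓ + m) + (ℓ′ + m′) → ∀ s t → s ≢ t →
                   Extra P (k + l) (R ⊕ S) (s ∷ []) ⊎ Extra P (k + l) (R ⊕ S) (t ∷ [])
      merge-some {ℓ = ℓ} {m = m} o o′ h s t s≢t with ℓ + m in eq
      ... | zero  = ⊎-map (join (none o)) (join (none o)) (some o′ h s t s≢t)
      ... | suc _ = ⊎-map (λ x → join x (none o′)) (λ x → join x (none o′))
                          (some o (subst (1 ≤_) (sym eq) (s≤s z≤n)) s t s≢t)

      -- The second family is offered the two sides other than `s`, so whichever it takes is new.
      with-some : ∀ {P k l R S s ℓ′ m′} → Extra P k R (s ∷ []) → Offers P l S ℓ′ m′ → 1 ≤ ℓ′ + m′ →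
                  ∃₂ λ s t → s ≢ t × Extra P (k + l) (R ⊕ S) (s ∷ t ∷ [])
      with-some {s = s} x o′ h =
        let r , r≢s , _   = third s s
            q , q≢s , q≢r = third s r
        in case some o′ h r q (q≢r ∘ sym) of λ where
          (inj₁ y) → s , r , r≢s ∘ sym , join x y
          (inj₂ y) → s , q , q≢s ∘ sym , join x y

      merge-pair : ∀ {P k l R S ℓ m ℓ′ m′} → Offers P k R ℓ m → Offers P l S ℓ′ m′ →
                   2 ≤ (ℓ + m) + (ℓ′ + m′) →
                   ∃₂ λ s t → s ≢ t × Extra P (k + l) (R ⊕ S) (s ∷ t ∷ [])
      merge-pair {ℓ = ℓ} {m = m} o o′ h with ℓ + m in eq
      ... | zero = let s , t , s≢t , x = pair o′ h in s , t , s≢t , join (none o) x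
      ... | suc (suc _) =
        let s , t , s≢t , x = pair o (subst (2 ≤_) (sym eq) (s≤s (s≤s z≤n))) in
        s , t , s≢t , join x (none o′)
      -- A single leaf or chain on the left settles its side first; offering it `A` and `B` is an
      -- arbitrary choice.
      ... | suc zero with some o (≤-reflexive (sym eq)) A B (λ ())
      ...   | inj₁ x = with-some x o′ (s≤s⁻¹ h)
      ...   | inj₂ x = with-some x o′ (s≤s⁻¹ h)

      -- The leaf takes whichever of the two sides the other family leaves over.
      leaf-some : ∀ {P k l R S ℓ m ℓ′ m′} → Offers P k R ℓ m → Offers P l S ℓ′ m′ →
                  1 ≤ ℓ → 1 ≤ ℓ′ + m′ → ∀ s t → s ≢ t → Extra P (k + l) (R ⊕ S) (s ∷ t ∷ [])
      leaf-some o o′ h h′ s t s≢t with some o′ h′ s t s≢t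
      ... | inj₁ x = swap (join (leaf o h t) x)
      ... | inj₂ x = join (leaf o h s) x

      some-leaf : ∀ {P k l R S ℓ m ℓ′ m′} → Offers P k R ℓ m → Offers P l S ℓ′ m′ →
                  1 ≤ ℓ + m → 1 ≤ ℓ′ → ∀ s t → s ≢ t → Extra P (k + l) (R ⊕ S) (s ∷ t ∷ [])
      some-leaf o o′ h h′ s t s≢t with some o h s t s≢t
      ... | inj₁ x = join x (leaf o′ h′ t)
      ... | inj₂ x = swap (join x (leaf o′ h′ s))

      -- Either one family alone has a leaf and a second member, or a leaf of one is matched with a
      -- member of the other.
      merge-two : ∀ {P k l R S ℓ m ℓ′ m′} → Offers P k R ℓ m → Offers P l S ℓ′ m′ →
                  1 ≤ ℓ + ℓ′ → 2 ≤ (ℓ + m) + (ℓ′ + m′) →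
                  ∀ s t → s ≢ t → Extra P (k + l) (R ⊕ S) (s ∷ t ∷ [])
      merge-two {ℓ = suc ℓ} {suc m} o o′ h h₂ s t s≢t =
        join (two o (s≤s z≤n) (s≤s (≤-trans (s≤s z≤n) (m≤n+m (suc m) ℓ))) s t s≢t) (none o′)
      merge-two {ℓ = suc (suc ℓ)} {zero} o o′ h h₂ s t s≢t =
        join (two o (s≤s z≤n) (s≤s (s≤s z≤n)) s t s≢t) (none o′)
      merge-two {ℓ = suc zero} {zero} o o′ h h₂ s t s≢t =
        leaf-some o o′ (s≤s z≤n) (s≤s⁻¹ h₂) s t s≢t
      merge-two {ℓ = zero} {zero} o o′ h h₂ s t s≢t = join (none o) (two o′ h h₂ s t s≢t)
      merge-two {ℓ = zero} {suc m} o o′ h h₂ s t s≢t = some-leaf o o′ (s≤s z≤n) h s t s≢t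

      merge : ∀ {P k l R S ℓ m ℓ′ m′} → Offers P k R ℓ m → Offers P l S ℓ′ m′ →
              Offers P (k + l) (R ⊕ S) (ℓ + ℓ′) (m + m′)
      merge {ℓ = ℓ} {m} {ℓ′} {m′} o o′ = record
        { none = join (none o) (none o′)
        ; leaf = merge-leaf o o′
        ; some = λ h → merge-some o o′ (subst (1 ≤_) regroup h)
        ; two  = λ h h₂ → merge-two o o′ h (subst (2 ≤_) regroup h₂)
        ; pair = λ h → merge-pair o o′ (subst (2 ≤_) regroup h)
        }
        where
        lemma : ∀ a b c d → a + b + (c + d) ≡ a + c + (b + d)
        lemma = solve-∀
        regroup : (ℓ + ℓ′) + (m + m′) ≡ (ℓ + m) + (ℓ′ + m′)
        regroup = lemma ℓ ℓ′ m m′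

    -- Deleted edges and the cost of covering.

    Edges : Set
    Edges = List (V × V)

    In : Edges → V → V → Set
    In F x y = (x , y) ∈ F ⊎ (y , x) ∈ F

    Hit : Edges → V → V → V → Set
    Hit F x y z = In F x y ⊎ In F x z ⊎ In F y z

    Full : Edges → V → V → V → Set
    Full F x y z = In F x y × In F x z × In F y z

    In-mono : ∀ {F F′ x y} → F ⊆ F′ → In F x y → In F′ x y
    In-mono s = ⊎-map s s

    Hit-mono : ∀ {F F′ x y z} → F ⊆ F′ → Hit F x y z → Hit F′ x y z
    Hit-mono s = ⊎-map (In-mono s) (⊎-map (In-mono s) (In-mono s))

    skip : ∀ {F : Edges} {x y e₀ e₁ e₂ e₃ e₄} → In F x y → In (e₀ ∷ e₁ ∷ e₂ ∷ e₃ ∷ e₄ ∷ F) x y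
    skip = In-mono (there ∘ there ∘ there ∘ there ∘ there)

    Mono : (Edges → Set) → Set
    Mono Q = ∀ {F F′} → F ⊆ F′ → Q F → Q F′

    record Cost (F : Edges) (Q : Edges → Set) (t : ℕ) : Set where
      constructor cost
      field
        added  : Edges
        cheap  : length added ≤ t
        covers : Q (added ++ F)

    cost-≤ : ∀ {F Q t t′} → t ≤ t′ → Cost F Q t → Cost F Q t′
    cost-≤ t≤t′ (cost D l q) = cost D (≤-trans l t≤t′) q

    -- Monotonicity lets each condition survive the edges added for the other.
    cost-∧ : ∀ {F Q Q′ t t′} → Mono Q → Mono Q′ → Cost F Q t → Cost F Q′ t′ →
             Cost F (λ F → Q F × Q′ F) (t + t′)
    cost-∧ {F} μ μ′ (cost D l q) (cost D′ l′ q′) = cost (D ++ D′)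
      (≤-trans (≤-reflexive (length-++ D)) (+-mono-≤ l l′))
      (μ left q , μ′ right q′)
      where
      left : D ++ F ⊆ (D ++ D′) ++ F
      left x with ∈-++⁻ D x
      ... | inj₁ y = ∈-++⁺ˡ (∈-++⁺ˡ y)
      ... | inj₂ y = ∈-++⁺ʳ (D ++ D′) y
      right : D′ ++ F ⊆ (D ++ D′) ++ F
      right x with ∈-++⁻ D′ x
      ... | inj₁ y = ∈-++⁺ˡ (∈-++⁺ʳ D y)
      ... | inj₂ y = ∈-++⁺ʳ (D ++ D′) y

    pay : ∀ {F Q t} E → Cost (E ++ F) Q t → Cost F Q (length E + t)
    pay {F} {Q} {t} E (cost D l q) = cost (D ++ E)
      (≤-trans (≤-reflexive (trans (length-++ D) (+-comm (length D) (length E)))) (+-monoʳ-≤ (length E) l))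
      (subst Q (sym (++-assoc D E F)) q)

    -- A side is named after the vertex opposite to it, an edge of the star after its end other than
    -- u. Thus `face` and `star` give opposite edges of the complete graph on u, a, b, c for the
    -- same letter.
    face : V → V → V → Side → Supply
    face a b c A = δ b c
    face a b c B = δ a c
    face a b c C = δ a b

    star : V → V → V → V → Side → Supply
    star u a b c A = δ u a
    star u a b c B = δ u b
    star u a b c C = δ u c

    -- Summaries of what is grown on a triangle.

    module Summaries (G : Graph n) where
      open Packings G
      open Extra

      -- What is left of some of the vertices grown on a b c: ℓ leaves and m chains; T edges
      -- and k triangles account for the removed vertices, and k also counts the triangle that
      -- each chain provides for free. R and Q describe the new edges and what is to be covered.
      record Summary (a b c : V) (R : Supply) (Q : Edges → Set) : Set where
        field
          T k ℓ m : ℕ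
          balance : 5 * T + 9 * m ≤ 9 * k
          mono    : Mono Q
          cost₁   : ∀ {F} → Hit F a b c → Cost F Q (T + (ℓ + 2 * m))
          cost₃   : ∀ {F} → Full F a b c → Cost F Q (T + m)
          offers  : Offers (face a b c) k R ℓ m

      -- Only a b c itself is to be covered, and both cost fields assume at least that it is hit.
      empty : ∀ {a b c} → Summary a b c ∅ (λ F → Hit F a b c)
      empty = record
        { T = 0 ; k = 0 ; ℓ = 0 ; m = 0
        ; balance = z≤n
        ; mono    = Hit-mono
        ; cost₁   = cost [] z≤n
        ; cost₃   = cost [] z≤n ∘ inj₁ ∘ proj₁
        ; offers  = record
          { none = extra nothing
          ; leaf = λ ()
          ; some = λ ()
          ; two  = λ ()
          ; pair = λ ()
          }
        }

      combine : ∀ {a b c R S Q Q′} → Summary a b c R Q → Summary a b c S Q′ →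
                Summary a b c (R ⊕ S) (λ F → Q F × Q′ F)
      combine x y = record
        { T = T x + T y ; k = k x + k y ; ℓ = ℓ x + ℓ y ; m = m x + m y
        ; balance = ≤-trans (≤-reflexive (distrib (T x) (T y) (m x) (m y)))
                   (≤-trans (+-mono-≤ (balance x) (balance y)) (≤-reflexive (sym (*-distribˡ-+ 9 (k x) (k y)))))
        ; mono    = λ s (p , q) → mono x s p , mono y s q
        ; cost₁   = λ h → cost-≤ (≤-reflexive (shuffle₁ (T x) (T y) (ℓ x) (ℓ y) (m x) (m y)))
                                (cost-∧ (mono x) (mono y) (cost₁ x h) (cost₁ y h))
        ; cost₃   = λ h → cost-≤ (≤-reflexive (shuffle₃ (T x) (T y) (m x) (m y)))
                                (cost-∧ (mono x) (mono y) (cost₃ x h) (cost₃ y h))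
        ; offers  = merge (offers x) (offers y)
        }
        where
        open Summary
        distrib : ∀ t t′ m m′ → 5 * (t + t′) + 9 * (m + m′) ≡ 5 * t + 9 * m + (5 * t′ + 9 * m′)
        distrib = solve-∀
        shuffle₁ : ∀ t t′ l l′ m m′ → t + (l + 2 * m) + (t′ + (l′ + 2 * m′)) ≡ t + t′ + (l + l′ + 2 * (m + m′))
        shuffle₁ = solve-∀
        shuffle₃ : ∀ t t′ m m′ → t + m + (t′ + m′) ≡ t + t′ + (m + m′)
        shuffle₃ = solve-∀

      -- The part of `Offers` that spends only the two edges at the new vertex. The third side lies
      -- on the parent triangle and is kept for use outside; `pair` is dropped because it might
      -- choose that side.
      record Restricted (P : Side → Supply) (s t : Side) (k : ℕ) (R : Supply) (ℓ m : ℕ) : Set where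
        field
          none  : Extra P k R []
          leafˡ : 1 ≤ ℓ → Extra P k R (s ∷ [])
          leafʳ : 1 ≤ ℓ → Extra P k R (t ∷ [])
          some  : 1 ≤ ℓ + m → Extra P k R (s ∷ []) ⊎ Extra P k R (t ∷ [])
          two   : 1 ≤ ℓ → 2 ≤ ℓ + m → Extra P k R (s ∷ t ∷ [])

        both : ∀ {x} → ℓ ≡ suc (suc x) → Extra P k R (s ∷ t ∷ [])
        both refl = two (s≤s z≤n) (s≤s (s≤s z≤n))

      restrict : ∀ {P P′ s t s′ t′ k R ℓ m} → s ≢ t → P s ≡ P′ s′ → P t ≡ P′ t′ →
                 Offers P k R ℓ m → Restricted P′ s′ t′ k R ℓ m
      restrict {P} {P′} {R = R} s≢t eq eq′ o = record
        { none  = extra (packing (none o))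
        ; leafˡ = λ h → at eq (leaf o h _)
        ; leafʳ = λ h → at eq′ (leaf o h _)
        ; some  = λ h → ⊎-map (at eq) (at eq′) (some o h _ _ s≢t)
        ; two   = λ h h₂ → extra (adapt (λ u w → cong₂ (λ X Y → X u w + (Y u w + 0) + R u w) eq eq′)
                                        (packing (two o h h₂ _ _ s≢t)))
        }
        where
        open Offers
        at : ∀ {s s′ k} → P s ≡ P′ s′ → Extra P k R (s ∷ []) → Extra P′ k R (s′ ∷ [])
        at eq (extra p) = extra (adapt (λ u w → cong (λ X → X u w + 0 + R u w) eq) p)

      -- A single node, from the summaries of its three new faces.

      module Node {a b c u} (abc : IsTriangle G (a , b , c))
                  (ua : Adj G u a) (ub : Adj G u b) (uc : Adj G u c)
                  {R₁ R₂ R₃ Q₁ Q₂ Q₃}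
                  (S₁ : Summary u b c R₁ Q₁) (S₂ : Summary u a c R₂ Q₂) (S₃ : Summary u a b R₃ Q₃)
                  where

        open Summary S₁ renaming (T to T₁; k to k₁; ℓ to ℓ₁; m to m₁;
                                   balance to balance₁; mono to mono₁;
                                   cost₁ to cost₁₁; cost₃ to cost₃₁; offers to offers₁)
        open Summary S₂ renaming (T to T₂; k to k₂; ℓ to ℓ₂; m to m₂;
                                   balance to balance₂; mono to mono₂;
                                   cost₁ to cost₁₂; cost₃ to cost₃₂; offers to offers₂)
        open Summary S₃ renaming (T to T₃; k to k₃; ℓ to ℓ₃; m to m₃;
                                   balance to balance₃; mono to mono₃;
                                   cost₁ to cost₁₃; cost₃ to cost₃₃; offers to offers₃)

        T K L M : ℕ
        T = T₁ + T₂ + T₃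
        K = k₁ + k₂ + k₃
        L = ℓ₁ + ℓ₂ + ℓ₃
        M = m₁ + m₂ + m₃

        P : Side → Supply
        P = star u a b c

        R N : Supply
        R = R₁ ⊕ R₂ ⊕ R₃
        N = all-sides P ⊕ R

        Q : Edges → Set
        Q F = (Q₁ F × Q₂ F) × Q₃ F

        mono : Mono Q
        mono s ((q₁ , q₂) , q₃) = (mono₁ s q₁ , mono₂ s q₂) , mono₃ s q₃

        balance : 5 * T + 9 * M ≤ 9 * K
        balance = ≤-trans (≤-reflexive (distrib T₁ T₂ T₃ m₁ m₂ m₃))
          (≤-trans (+-mono-≤ (+-mono-≤ balance₁ balance₂) balance₃) (≤-reflexive (distrib₉ k₁ k₂ k₃)))
          where
          distrib : ∀ x y z p q r → 5 * (x + y + z) + 9 * (p + q + r)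
                                  ≡ 5 * x + 9 * p + (5 * y + 9 * q) + (5 * z + 9 * r)
          distrib = solve-∀
          distrib₉ : ∀ x y z → 9 * x + 9 * y + 9 * z ≡ 9 * (x + y + z)
          distrib₉ = solve-∀

        all-costs : ∀ {F t₁ t₂ t₃} → Cost F Q₁ t₁ → Cost F Q₂ t₂ → Cost F Q₃ t₃ → Cost F Q (t₁ + t₂ + t₃)
        all-costs x y z = cost-∧ (λ s (p , q) → mono₁ s p , mono₂ s q) mono₃ (cost-∧ mono₁ mono₂ x y) z

        collect : ∀ j → j + (T₁ + (ℓ₁ + 2 * m₁) + (T₂ + (ℓ₂ + 2 * m₂)) + (T₃ + (ℓ₃ + 2 * m₃)))
                      ≡ (j + L + 2 * M) + T
        collect j = lemma j T₁ T₂ T₃ ℓ₁ ℓ₂ ℓ₃ m₁ m₂ m₃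
          where
          lemma : ∀ j t₁ t₂ t₃ l₁ l₂ l₃ m₁ m₂ m₃ →
            j + (t₁ + (l₁ + 2 * m₁) + (t₂ + (l₂ + 2 * m₂)) + (t₃ + (l₃ + 2 * m₃)))
            ≡ (j + (l₁ + l₂ + l₃) + 2 * (m₁ + m₂ + m₃)) + (t₁ + t₂ + t₃)
          lemma = solve-∀

        -- Each new face shares an edge with a b c, so all three are hit already.
        cost-full : ∀ {F} → Full F a b c → Cost F Q ((L + 2 * M) + T)
        cost-full (ab , ac , bc) = cost-≤ (≤-reflexive (collect 0))
          (all-costs (cost₁₁ (inj₂ (inj₂ bc))) (cost₁₂ (inj₂ (inj₂ ac))) (cost₁₃ (inj₂ (inj₂ ab))))

        -- A deleted side of a b c hits one new face; the other two share the edge from u to the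
        -- vertex opposite that side.
        cost-generic : ∀ {F} → Hit F a b c → Cost F Q ((1 + L + 2 * M) + T)
        cost-generic = cost-≤ (≤-reflexive (collect 1)) ∘ λ where
          (inj₁ ab) → pay ((u , c) ∷ []) (all-costs
            (cost₁₁ (inj₂ (inj₁ (inj₁ (here refl)))))
            (cost₁₂ (inj₂ (inj₁ (inj₁ (here refl)))))
            (cost₁₃ (inj₂ (inj₂ (In-mono there ab)))))
          (inj₂ (inj₁ ac)) → pay ((u , b) ∷ []) (all-costs
            (cost₁₁ (inj₁ (inj₁ (here refl))))
            (cost₁₂ (inj₂ (inj₂ (In-mono there ac))))
            (cost₁₃ (inj₂ (inj₁ (inj₁ (here refl))))))
          (inj₂ (inj₂ bc)) → pay ((u , a) ∷ []) (all-costs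
            (cost₁₁ (inj₂ (inj₂ (In-mono there bc))))
            (cost₁₂ (inj₁ (inj₁ (here refl))))
            (cost₁₃ (inj₁ (inj₁ (here refl)))))

        cost-star : ∀ {F} → Full F a b c → In F u a → In F u b → In F u c → Cost F Q (M + T)
        cost-star (ab , ac , bc) ua ub uc = cost-≤ (≤-reflexive (lemma T₁ T₂ T₃ m₁ m₂ m₃))
          (all-costs (cost₃₁ (ub , uc , bc)) (cost₃₂ (ua , uc , ac)) (cost₃₃ (ua , ub , ab)))
          where
          lemma : ∀ t₁ t₂ t₃ m₁ m₂ m₃ → t₁ + m₁ + (t₂ + m₂) + (t₃ + m₃) ≡ m₁ + m₂ + m₃ + (t₁ + t₂ + t₃)
          lemma = solve-∀

        -- Five more edges complete the deletion of all six edges on u, a, b, c. All new faces are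
        -- then full, so leaves are free and every chain costs one.
        cost-everything : ∀ {F} → Hit F a b c → Cost F Q ((5 + M) + T)
        cost-everything (inj₁ ab) = pay ((u , a) ∷ (u , b) ∷ (u , c) ∷ (a , c) ∷ (b , c) ∷ [])
          (cost-star (skip ab , inj₁ #3 , inj₁ #4) (inj₁ #0) (inj₁ #1) (inj₁ #2))
        cost-everything (inj₂ (inj₁ ac)) = pay ((u , a) ∷ (u , b) ∷ (u , c) ∷ (a , b) ∷ (b , c) ∷ [])
          (cost-star (inj₁ #3 , skip ac , inj₁ #4) (inj₁ #0) (inj₁ #1) (inj₁ #2))
        cost-everything (inj₂ (inj₂ bc)) = pay ((u , a) ∷ (u , b) ∷ (u , c) ∷ (a , b) ∷ (a , c) ∷ [])
          (cost-star (inj₁ #3 , inj₁ #4 , skip bc) (inj₁ #0) (inj₁ #1) (inj₁ #2))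

        -- Deleting all of u b c frees its leaves and also hits the other two new faces, through u c
        -- and u b.
        cost-side₁ : ∀ {F} → ℓ₂ + ℓ₃ ≤ 0 → Cost F Q ((3 + 2 * M) + T)
        cost-side₁ h = cost-≤ (one-sided T₁ T₂ T₃ m₁ m₂ m₃ ℓ₂ ℓ₃ h)
          (pay ((u , b) ∷ (u , c) ∷ (b , c) ∷ []) (all-costs
            (cost₃₁ (inj₁ #0 , inj₁ #1 , inj₁ #2))
            (cost₁₂ (inj₂ (inj₁ (inj₁ #1))))
            (cost₁₃ (inj₂ (inj₁ (inj₁ #0))))))

        cost-side₂ : ∀ {F} → ℓ₁ + ℓ₃ ≤ 0 → Cost F Q ((3 + 2 * M) + T)
        cost-side₂ h = cost-≤
          (≤-trans (≤-reflexive (lemma (T₁ + (ℓ₁ + 2 * m₁)) (T₂ + m₂) (T₃ + (ℓ₃ + 2 * m₃))))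
          (≤-trans (one-sided T₂ T₁ T₃ m₂ m₁ m₃ ℓ₁ ℓ₃ h) (≤-reflexive (lemma′ T₁ T₂ T₃ m₁ m₂ m₃))))
          (pay ((u , a) ∷ (u , c) ∷ (a , c) ∷ []) (all-costs
            (cost₁₁ (inj₂ (inj₁ (inj₁ #1)))) (cost₃₂ (inj₁ #0 , inj₁ #1 , inj₁ #2)) (cost₁₃ (inj₁ (inj₁ #0)))))
          where
          lemma : ∀ x y z → 3 + (x + y + z) ≡ 3 + (y + x + z)
          lemma = solve-∀
          lemma′ : ∀ t₁ t₂ t₃ m₁ m₂ m₃ → 
            (3 + 2 * (m₂ + m₁ + m₃)) + (t₂ + t₁ + t₃)
            ≡ (3 + 2 * (m₁ + m₂ + m₃)) + (t₁ + t₂ + t₃)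
          lemma′ = solve-∀

        cost-side₃ : ∀ {F} → ℓ₁ + ℓ₂ ≤ 0 → Cost F Q ((3 + 2 * M) + T)
        cost-side₃ h = cost-≤
          (≤-trans (≤-reflexive (lemma (T₁ + (ℓ₁ + 2 * m₁)) (T₂ + (ℓ₂ + 2 * m₂)) (T₃ + m₃)))
          (≤-trans (one-sided T₃ T₁ T₂ m₃ m₁ m₂ ℓ₁ ℓ₂ h) (≤-reflexive (lemma′ T₁ T₂ T₃ m₁ m₂ m₃))))
          (pay ((u , a) ∷ (u , b) ∷ (a , b) ∷ []) (all-costs
            (cost₁₁ (inj₁ (inj₁ #1))) (cost₁₂ (inj₁ (inj₁ #0))) (cost₃₃ (inj₁ #0 , inj₁ #1 , inj₁ #2))))
          where
          lemma : ∀ x y z → 3 + (x + y + z) ≡ 3 + (z + x + y)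
          lemma = solve-∀
          lemma′ : ∀ t₁ t₂ t₃ m₁ m₂ m₃ → 
            (3 + 2 * (m₃ + m₁ + m₂)) + (t₃ + t₁ + t₂)
            ≡ (3 + 2 * (m₁ + m₂ + m₃)) + (t₁ + t₂ + t₃)
          lemma′ = solve-∀

        -- Triangles available at a node.

        restricted₁ : Restricted P B C k₁ R₁ ℓ₁ m₁
        -- Sides `C` and `B` of the face u b c are the edges u b and u c, which the star calls `B`
        -- and `C`.
        restricted₁ = restrict {P = face u b c} {s = C} {B} (λ ()) refl refl offers₁
        module σ₁ = Restricted restricted₁
        restricted₂ : Restricted P A C k₂ R₂ ℓ₂ m₂
        restricted₂ = restrict {P = face u a c} {s = C} {B} (λ ()) refl refl offers₂
        module σ₂ = Restricted restricted₂
        restricted₃ : Restricted P A B k₃ R₃ ℓ₃ m₃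
        restricted₃ = restrict {P = face u a b} {s = C} {B} (λ ()) refl refl offers₃
        module σ₃ = Restricted restricted₃

        -- The extra triangles below u share only the three star edges, so it is enough that no star
        -- edge is spent twice. The implicit argument settles this by evaluation.
        take : ∀ {L₁ L₂ L₃} → Extra P k₁ R₁ L₁ → Extra P k₂ R₂ L₂ → Extra P k₃ R₃ L₃ →
               {True (distinct? ((L₁ ++ L₂) ++ L₃))} → Pack (length ((L₁ ++ L₂) ++ L₃) + K) N
        take x y z {d} = within (toWitness d) (join (join x y) z)

        take₀ : Pack K N
        take₀ = take σ₁.none σ₂.none σ₃.none

        -- Any one chain suffices: it accepts at least one of the two star edges on its face.
        take₁ : 1 ≤ M → Pack (1 + K) N
        take₁ = pick refl refl refl
          where
          more : ∀ {l m x} → m ≡ suc x → 1 ≤ l + m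
          more {l} refl = ≤-trans (s≤s z≤n) (m≤n+m _ l)
          pick : ∀ {x y z} → m₁ ≡ x → m₂ ≡ y → m₃ ≡ z → 1 ≤ x + y + z → Pack (1 + K) N
          pick {suc _} p q r h = case σ₁.some (more p) of λ where
            (inj₁ x) → take x σ₂.none σ₃.none
            (inj₂ x) → take x σ₂.none σ₃.none
          pick {zero} {suc _} p q r h = case σ₂.some (more q) of λ where
            (inj₁ x) → take σ₁.none x σ₃.none
            (inj₂ x) → take σ₁.none x σ₃.none
          pick {zero} {zero} {suc _} p q r h = case σ₃.some (more r) of λ where
            (inj₁ x) → take σ₁.none σ₂.none x
            (inj₂ x) → take σ₁.none σ₂.none x

        -- The leaf accepts both star edges on its face, so it can give way to the edge taken by the
        -- second leaf or chain.
        take₂-side₁ : 1 ≤ ℓ₁ → 2 ≤ ℓ₁ + m₁ ⊎ 1 ≤ ℓ₂ + m₂ ⊎ 1 ≤ ℓ₃ + m₃ → Pack (2 + K) N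
        take₂-side₁ h (inj₁ h₂) = take (σ₁.two h h₂) σ₂.none σ₃.none
        take₂-side₁ h (inj₂ (inj₁ h₂)) = case σ₂.some h₂ of λ where
          (inj₁ x) → take (σ₁.leafˡ h) x σ₃.none
          (inj₂ x) → take (σ₁.leafˡ h) x σ₃.none
        take₂-side₁ h (inj₂ (inj₂ h₂)) = case σ₃.some h₂ of λ where
          (inj₁ x) → take (σ₁.leafˡ h) σ₂.none x
          (inj₂ x) → take (σ₁.leafʳ h) σ₂.none x

        take₂-side₂ : 1 ≤ ℓ₂ → 2 ≤ ℓ₂ + m₂ ⊎ 1 ≤ ℓ₁ + m₁ ⊎ 1 ≤ ℓ₃ + m₃ → Pack (2 + K) N
        take₂-side₂ h (inj₁ h₂) = take σ₁.none (σ₂.two h h₂) σ₃.none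
        take₂-side₂ h (inj₂ (inj₁ h₂)) = case σ₁.some h₂ of λ where
          (inj₁ x) → take x (σ₂.leafˡ h) σ₃.none
          (inj₂ x) → take x (σ₂.leafˡ h) σ₃.none
        take₂-side₂ h (inj₂ (inj₂ h₂)) = case σ₃.some h₂ of λ where
          (inj₁ x) → take σ₁.none (σ₂.leafʳ h) x
          (inj₂ x) → take σ₁.none (σ₂.leafˡ h) x

        take₂-side₃ : 1 ≤ ℓ₃ → 2 ≤ ℓ₃ + m₃ ⊎ 1 ≤ ℓ₁ + m₁ ⊎ 1 ≤ ℓ₂ + m₂ → Pack (2 + K) N
        take₂-side₃ h (inj₁ h₂) = take σ₁.none σ₂.none (σ₃.two h h₂)
        take₂-side₃ h (inj₂ (inj₁ h₂)) = case σ₁.some h₂ of λ where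
          (inj₁ x) → take x σ₂.none (σ₃.leafˡ h)
          (inj₂ x) → take x σ₂.none (σ₃.leafˡ h)
        take₂-side₃ h (inj₂ (inj₂ h₂)) = case σ₂.some h₂ of λ where
          (inj₁ x) → take σ₁.none x (σ₃.leafʳ h)
          (inj₂ x) → take σ₁.none x (σ₃.leafˡ h)

        -- The two edges from u to the ends of side `s` of a b c.
        others : Side → Supply
        others A = P B ⊕ P C
        others B = P A ⊕ P C
        others C = P A ⊕ P B

        others-all : ∀ s v w → P s v w + others s v w ≡ all-sides P v w
        others-all A v w = lemma (P A v w) (P B v w) (P C v w)
          where
          lemma : ∀ a b c → a + (b + c) ≡ a + b + c
          lemma = solve-∀
        others-all B v w = lemma (P A v w) (P B v w) (P C v w)
          where
          lemma : ∀ a b c → b + (a + c) ≡ a + b + c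
          lemma = solve-∀
        others-all C v w = lemma (P A v w) (P B v w) (P C v w)
          where
          lemma : ∀ a b c → c + (a + b) ≡ a + b + c
          lemma = solve-∀

        cap : ∀ s → Pack 1 (others s ⊕ face a b c s)
        cap A = single (ub , uc , proj₂ (proj₂ abc))
        cap B = single (ua , uc , proj₁ (proj₂ abc))
        cap C = single (ua , ub , proj₁ abc)

        leaf-extra : ∀ s → Extra (face a b c) K N (s ∷ [])
        leaf-extra s = extra (weaken ≤-refl fit (union (cap s) (packing (join (join σ₁.none σ₂.none) σ₃.none))))
          where
          lemma : ∀ o f r p → o + f + r + p ≡ f + 0 + (p + o + r)
          lemma = solve-∀
          fit : (others s ⊕ face a b c s) ⊕ R ≼ (face a b c s ⊕ ∅) ⊕ N
          fit v w = ≤-trans (m≤m+n _ (P s v w)) (≤-reflexive (trans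
            (lemma (others s v w) (face a b c s v w) (R v w) (P s v w))
            (cong (λ x → face a b c s v w + 0 + (x + R v w)) (others-all s v w))))

        -- The leaf below u takes the star edge `P s`, while `cap s` takes the other two together
        -- with side `s`, so both triangles fit.
        chain-extra : ∀ {s} → Extra P K R (s ∷ []) → Extra (face a b c) (1 + K) N (s ∷ [])
        chain-extra {s} (extra p) = extra (adapt fit (union (cap s) p))
          where
          lemma : ∀ o f r p → o + f + (p + 0 + r) ≡ f + 0 + (p + o + r)
          lemma = solve-∀
          fit : ∀ v w → others s v w + face a b c s v w + (P s v w + 0 + R v w) ≡ face a b c s v w + 0 + N v w
          fit v w = trans
            (lemma (others s v w) (face a b c s v w) (R v w) (P s v w))
            (cong (λ x → face a b c s v w + 0 + (x + R v w)) (others-all s v w))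

        -- The outcomes for a node: leaf, chain or removal.

        leaf-node : L ≡ 0 → M ≡ 0 → Summary a b c N Q
        leaf-node L≡0 M≡0 = record
          -- The accounts of the removed descendants pass on unchanged; u itself is recorded only in
          -- `ℓ`.
          { T = T ; k = K ; ℓ = 1 ; m = 0
          ; balance = ≤-trans (+-monoʳ-≤ (5 * T) z≤n) balance
          ; mono    = mono
          ; cost₁   = λ h → cost-≤ (≤-reflexive (trans (cong₂ (λ l m → 1 + l + 2 * m + T) L≡0 M≡0) (+-comm 1 T)))
                                  (cost-generic h)
          ; cost₃   = λ h → cost-≤ (≤-reflexive (trans (cong₂ (λ l m → l + 2 * m + T) L≡0 M≡0)
                                                    (sym (+-identityʳ T))))
                                  (cost-full h)
          ; offers  = record
            { none = extra take₀
            ; leaf = λ _ → leaf-extra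
            ; some = λ _ s _ _ → inj₁ (leaf-extra s)
            ; two  = λ { _ (s≤s ()) }
            ; pair = λ { (s≤s ()) }
            }
          }

        -- The letter `d` names the vertex of a b c missing from the face that carries the leaf. The
        -- leaf can use the other two star edges, so the chain serves every side except `d`; `p` is
        -- its free triangle.
        chain-node : ∀ d → (∀ s → s ≢ d → Extra P K R (s ∷ [])) → Pack (1 + K) N →
                     L ≡ 1 → M ≡ 0 → Summary a b c N Q
        chain-node d e p L≡1 M≡0 = record
          { T = T ; k = 1 + K ; ℓ = 0 ; m = 1
          ; balance = ≤-trans (+-monoˡ-≤ 9 (≤-trans (m≤m+n (5 * T) (9 * M)) balance))
                              (≤-reflexive (trans (+-comm (9 * K) 9) (sym (*-distribˡ-+ 9 1 K))))
          ; mono    = mono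
          ; cost₁   = λ h → cost-≤ (≤-reflexive (trans (cong₂ (λ l m → 1 + l + 2 * m + T) L≡1 M≡0) (+-comm 2 T)))
                                  (cost-generic h)
          ; cost₃   = λ h → cost-≤ (≤-reflexive (trans (cong₂ (λ l m → l + 2 * m + T) L≡1 M≡0) (+-comm 1 T)))
                                  (cost-full h)
          ; offers  = record
            { none = extra p
            ; leaf = λ ()
            ; some = λ _ → avoid d λ s s≢d → chain-extra (e s s≢d)
            ; two  = λ ()
            ; pair = λ { (s≤s ()) }
            }
          }

        -- Removing u dissolves the chains below it. The 9 M reserved for them in `balance`,
        -- together with 9 j for the new triangles, pays for `t` edges.
        reduced : ∀ t j → 5 * t ≤ 9 * (j + M) → Pack (j + K) N →
                  (∀ {F} → Hit F a b c → Cost F Q (t + T)) → Summary a b c N Q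
        reduced t j 5t≤9j p c = record
          { T = t + T ; k = j + K ; ℓ = 0 ; m = 0
          ; balance = +-cancelʳ-≤ (9 * M) _ _ (≤-trans (≤-reflexive (left t T M))
                     (≤-trans (+-mono-≤ 5t≤9j balance) (≤-reflexive (right j K M))))
          ; mono    = mono
          ; cost₁   = cost-≤ (≤-reflexive (sym (+-identityʳ (t + T)))) ∘ c
          ; cost₃   = cost-≤ (≤-reflexive (sym (+-identityʳ (t + T)))) ∘ c ∘ inj₁ ∘ proj₁
          ; offers  = record
            { none = extra p
            ; leaf = λ ()
            ; some = λ ()
            ; two  = λ ()
            ; pair = λ ()
            }
          }
          where
          left : ∀ t T M → 5 * (t + T) + 9 * 0 + 9 * M ≡ 5 * t + (5 * T + 9 * M)
          left = solve-∀
          right : ∀ j K M → 9 * (j + M) + 9 * K ≡ 9 * (j + K) + 9 * M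
          right = solve-∀

        reduced₁ : L ≡ 0 → 1 ≤ M → Summary a b c N Q
        -- The inequality 5 (1 + 2 M) ≤ 9 (1 + M) means M ≤ 4, and 5 (5 + M) ≤ 9 (1 + M) means M ≥
        -- 4.
        reduced₁ L≡0 1≤M with M ≤? 4
        ... | yes M≤4 = reduced (1 + 2 * M) 1 (bound M≤4) (take₁ 1≤M)
                          (λ h → cost-≤ (≤-reflexive (cong (λ l → 1 + l + 2 * M + T) L≡0)) (cost-generic h))
          where
          left : ∀ M → 5 * (1 + 2 * M) ≡ M + (5 + 9 * M)
          left = solve-∀
          right : ∀ M → 4 + (5 + 9 * M) ≡ 9 * (1 + M)
          right = solve-∀
          bound : ∀ {M} → M ≤ 4 → 5 * (1 + 2 * M) ≤ 9 * (1 + M)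
          bound {M} h = ≤-trans (≤-reflexive (left M))
            (≤-trans (+-monoˡ-≤ (5 + 9 * M) h) (≤-reflexive (right M)))
        ... | no M≰4 = reduced (5 + M) 1 (bound (<⇒≤ (≰⇒> M≰4))) (take₁ 1≤M) cost-everything
          where
          left : ∀ M → 5 * (5 + M) ≡ 4 * 4 + (9 + 5 * M)
          left = solve-∀
          right : ∀ M → 4 * M + (9 + 5 * M) ≡ 9 * (1 + M)
          right = solve-∀
          bound : ∀ {M} → 4 ≤ M → 5 * (5 + M) ≤ 9 * (1 + M)
          bound {M} h = ≤-trans (≤-reflexive (left M))
            (≤-trans (+-monoˡ-≤ (9 + 5 * M) (*-monoʳ-≤ 4 h)) (≤-reflexive (right M)))

        reduced₂ : Pack (2 + K) N → (∀ {F} → Hit F a b c → Cost F Q ((3 + 2 * M) + T)) → Summary a b c N Q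
        -- The inequality 5 (3 + 2 M) ≤ 9 (2 + M) means M ≤ 3, while 5 (5 + M) ≤ 9 (2 + M) holds
        -- from M = 2 on.
        reduced₂ p c with M ≤? 3
        ... | yes M≤3 = reduced (3 + 2 * M) 2 (bound M≤3) p c
          where
          left : ∀ M → 5 * (3 + 2 * M) ≡ M + (15 + 9 * M)
          left = solve-∀
          right : ∀ M → 3 + (15 + 9 * M) ≡ 9 * (2 + M)
          right = solve-∀
          bound : ∀ {M} → M ≤ 3 → 5 * (3 + 2 * M) ≤ 9 * (2 + M)
          bound {M} h = ≤-trans (≤-reflexive (left M))
            (≤-trans (+-monoˡ-≤ (15 + 9 * M) h) (≤-reflexive (right M)))
        ... | no M≰3 = reduced (5 + M) 2 (bound (<⇒≤ (≰⇒> M≰3))) p cost-everything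
          where
          left : ∀ M → 5 * (5 + M) + 5 ≡ 4 * 3 + (18 + 5 * M)
          left = solve-∀
          right : ∀ M → 4 * M + (18 + 5 * M) ≡ 9 * (2 + M)
          right = solve-∀
          bound : ∀ {M} → 3 ≤ M → 5 * (5 + M) ≤ 9 * (2 + M)
          bound {M} h = ≤-trans (m≤m+n _ 5) (≤-trans (≤-reflexive (left M))
            (≤-trans (+-monoˡ-≤ (18 + 5 * M) (*-monoʳ-≤ 4 h)) (≤-reflexive (right M))))

        reduced₃ : Pack (3 + K) N → Summary a b c N Q
        -- Three triangles pay for five edges whatever M is; the slack is 2 + 4 M.
        reduced₃ p = reduced (5 + M) 3
          (≤-trans (m≤m+n _ (2 + 4 * M)) (≤-reflexive (lemma M))) p cost-everything
          where
          lemma : ∀ M → 5 * (5 + M) + (2 + 4 * M) ≡ 9 * (3 + M)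
          lemma = solve-∀

        few-leaves : L ≤ 2 → ∀ {F} → Hit F a b c → Cost F Q ((3 + 2 * M) + T)
        few-leaves L≤2 h = cost-≤ (+-monoˡ-≤ T (+-monoˡ-≤ (2 * M) (s≤s L≤2))) (cost-generic h)

        classify : ∀ {x y z} → ℓ₁ ≡ x → ℓ₂ ≡ y → ℓ₃ ≡ z → Summary a b c N Q
        classify {zero} {zero} {zero} p q r with M in eq
        ... | zero  = leaf-node (cong₂ _+_ (cong₂ _+_ p q) r) eq
        ... | suc _ = reduced₁ (cong₂ _+_ (cong₂ _+_ p q) r) (subst (1 ≤_) (sym eq) (s≤s z≤n))
        -- All leaves on one face: a lone leaf without chains makes u a chain, and otherwise two
        -- extra triangles exist.
        classify {suc x} {zero} {zero} p q r with crowded? x m₁ m₂ m₃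
        ... | inj₁ (e , e₂ , e₃) =
          let l , e₁ = one-leaf p e in
          chain-node A (λ { A h → ⊥-elim (h refl)
                          ; B _ → join (join (σ₁.leafˡ (has p)) σ₂.none) σ₃.none
                          ; C _ → join (join (σ₁.leafʳ (has p)) σ₂.none) σ₃.none })
            (take (σ₁.leafˡ (has p)) σ₂.none σ₃.none)
            (cong₂ _+_ (cong₂ _+_ l q) r) (cong₂ _+_ (cong₂ _+_ e₁ e₂) e₃)
        ... | inj₂ h = reduced₂ (take₂-side₁ (has p) (⊎-map (has-two p) (⊎-map (has-chain ℓ₂) (has-chain ℓ₃)) h))
                                (λ _ → cost-side₁ (≤-reflexive (cong₂ _+_ q r)))
        classify {zero} {suc y} {zero} p q r with crowded? y m₂ m₁ m₃
        ... | inj₁ (e , e₁ , e₃) =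
          let l , e₂ = one-leaf q e in
          chain-node B (λ { B h → ⊥-elim (h refl)
                          ; A _ → join (join σ₁.none (σ₂.leafˡ (has q))) σ₃.none
                          ; C _ → join (join σ₁.none (σ₂.leafʳ (has q))) σ₃.none })
            (take σ₁.none (σ₂.leafˡ (has q)) σ₃.none)
            (cong₂ _+_ (cong₂ _+_ p l) r) (cong₂ _+_ (cong₂ _+_ e₁ e₂) e₃)
        ... | inj₂ h = reduced₂ (take₂-side₂ (has q) (⊎-map (has-two q) (⊎-map (has-chain ℓ₁) (has-chain ℓ₃)) h))
                                (λ _ → cost-side₂ (≤-reflexive (cong₂ _+_ p r)))
        classify {zero} {zero} {suc z} p q r with crowded? z m₃ m₁ m₂
        ... | inj₁ (e , e₁ , e₂) =
          let l , e₃ = one-leaf r e in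
          chain-node C (λ { C h → ⊥-elim (h refl)
                          ; A _ → join (join σ₁.none σ₂.none) (σ₃.leafˡ (has r))
                          ; B _ → join (join σ₁.none σ₂.none) (σ₃.leafʳ (has r)) })
            (take σ₁.none σ₂.none (σ₃.leafˡ (has r)))
            (cong₂ _+_ (cong₂ _+_ p q) l) (cong₂ _+_ (cong₂ _+_ e₁ e₂) e₃)
        ... | inj₂ h = reduced₂ (take₂-side₃ (has r) (⊎-map (has-two r) (⊎-map (has-chain ℓ₁) (has-chain ℓ₂)) h))
                                (λ _ → cost-side₃ (≤-reflexive (cong₂ _+_ p q)))
        -- One leaf on each of two faces: two triangles, and so few leaves that the generic cost
        -- suffices.
        classify {suc zero} {suc zero} {zero} p q r =
          reduced₂ (take (σ₁.leafˡ (has p)) (σ₂.leafˡ (has q)) σ₃.none)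
                   (few-leaves (≤-reflexive (cong₂ _+_ (cong₂ _+_ p q) r)))
        classify {suc zero} {zero} {suc zero} p q r =
          reduced₂ (take (σ₁.leafˡ (has p)) σ₂.none (σ₃.leafˡ (has r)))
                   (few-leaves (≤-reflexive (cong₂ _+_ (cong₂ _+_ p q) r)))
        classify {zero} {suc zero} {suc zero} p q r =
          reduced₂ (take σ₁.none (σ₂.leafʳ (has q)) (σ₃.leafˡ (has r)))
                   (few-leaves (≤-reflexive (cong₂ _+_ (cong₂ _+_ p q) r)))
        -- Two leaves on one face spend both of its star edges, and a leaf on another face spends
        -- the third.
        classify {suc (suc _)} {suc _} {zero} p q r = reduced₃ (take (σ₁.both p) (σ₂.leafˡ (has q)) σ₃.none)
        classify {suc zero} {suc (suc _)} {zero} p q r = reduced₃ (take (σ₁.leafˡ (has p)) (σ₂.both q) σ₃.none)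
        classify {suc (suc _)} {zero} {suc _} p q r = reduced₃ (take (σ₁.both p) σ₂.none (σ₃.leafˡ (has r)))
        classify {suc zero} {zero} {suc (suc _)} p q r = reduced₃ (take (σ₁.leafʳ (has p)) σ₂.none (σ₃.both r))
        classify {zero} {suc (suc _)} {suc _} p q r = reduced₃ (take σ₁.none (σ₂.both q) (σ₃.leafʳ (has r)))
        classify {zero} {suc zero} {suc (suc _)} p q r = reduced₃ (take σ₁.none (σ₂.leafʳ (has q)) (σ₃.both r))
        classify {suc _} {suc _} {suc _} p q r =
          reduced₃ (take (σ₁.leafˡ (has p)) (σ₂.leafʳ (has q)) (σ₃.leafˡ (has r)))

        summary : Summary a b c N Q
        summary = classify refl refl refl

    -- Forests grown on a triangle, and the bound at the initial triangle.

    module Forests (G : Graph n) where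
      open Packings G
      open Extra
      open Summaries G

      -- 3-trees grown on a triangle a b c: each node is a vertex u joined to a, b, c,
      -- with what is grown on u b c, on u a c and on u a b, and the rest grown on a b c.
      data Forest (a b c : V) : Set where
        nil  : Forest a b c
        node : ∀ u → Adj G u a → Adj G u b → Adj G u c →
               Forest u b c → Forest u a c → Forest u a b → Forest a b c → Forest a b c

      supply : ∀ {a b c} → Forest a b c → Supply
      supply nil = ∅
      supply {a} {b} {c} (node u _ _ _ f₁ f₂ f₃ g) =
        (all-sides (star u a b c) ⊕ (supply f₁ ⊕ supply f₂ ⊕ supply f₃)) ⊕ supply g

      total : ∀ {a b c} → Forest a b c → Supply
      total {a} {b} {c} f = all-sides (face a b c) ⊕ supply f

      -- The condition on a b c itself appears once, at the end of the list of nodes grown on it.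
      Covers : ∀ {a b c} → Forest a b c → Edges → Set
      Covers {a} {b} {c} nil                    F = Hit F a b c
      Covers             (node u _ _ _ f₁ f₂ f₃ g) F = ((Covers f₁ F × Covers f₂ F) × Covers f₃ F) × Covers g F

      summary : ∀ {a b c} → IsTriangle G (a , b , c) → (f : Forest a b c) →
                Summary a b c (supply f) (Covers f)
      summary abc nil = empty
      summary abc@(ab , ac , bc) (node u ua ub uc f₁ f₂ f₃ g) = combine
        (Node.summary abc ua ub uc
          (summary (ub , uc , bc) f₁) (summary (ua , uc , ac) f₂) (summary (ua , ub , ab) f₃))
        (summary abc g)

      -- With at most one leaf or chain left it is cheapest to delete a single side. With two or
      -- more, all three sides are deleted, and two different sides serve extra triangles.
      root-bound : ∀ {a b c} → IsTriangle G (a , b , c) → (f : Forest a b c) →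
                   ∃₂ λ t k → 5 * t ≤ 9 * k + 1 × Pack k (total f) × Cost [] (Covers f) t
      root-bound {a} {b} {c} abc@(ab , ac , bc) f = choose (ℓ + m) refl
        where
        open Summary (summary abc f)
        open Offers offers

        P : Side → Supply
        P = face a b c

        root-triangle : Pack 1 (all-sides P)
        root-triangle = adapt (λ u w → reverse (δ a b u w) (δ a c u w) (δ b c u w)) (single abc)
          where
          reverse : ∀ x y z → x + y + z ≡ z + y + x
          reverse = solve-∀

        -- Writing ℓ + 2 m as (ℓ + m) + m lets the case distinction on ℓ + m fix everything except
        -- `m`.
        cost-ab : ∀ {x} → ℓ + m ≡ x → Cost [] (Covers f) (1 + (T + (x + m)))
        cost-ab refl = cost-≤ (≤-reflexive (lemma T ℓ m)) (pay ((a , b) ∷ []) (cost₁ (inj₁ (inj₁ (here refl)))))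
          where
          lemma : ∀ T ℓ m → 1 + (T + (ℓ + 2 * m)) ≡ 1 + (T + (ℓ + m + m))
          lemma = solve-∀

        cost-abc : Cost [] (Covers f) (3 + (T + m))
        cost-abc = pay ((a , b) ∷ (a , c) ∷ (b , c) ∷ [])
          (cost₃ (inj₁ (here refl) , inj₁ (there (here refl)) , inj₁ (there (there (here refl)))))

        -- Adding `balance` puts 9 m on both sides, where it cancels.
        bound : ∀ {i j} → 5 * (i + m) ≤ 9 * (j + m) + 1 → 5 * (i + (T + m)) ≤ 9 * (j + k) + 1
        bound {i} {j} h = +-cancelʳ-≤ (9 * m) _ _ (≤-trans (≤-reflexive (left i T m))
          (≤-trans (+-mono-≤ h balance) (≤-reflexive (right j k m))))
          where
          left : ∀ i T m → 5 * (i + (T + m)) + 9 * m ≡ 5 * (i + m) + (5 * T + 9 * m)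
          left = solve-∀
          right : ∀ j k m → 9 * (j + m) + 1 + 9 * k ≡ 9 * (j + k) + 1 + 9 * m
          right = solve-∀

        five≤nine : ∀ {i j} → 5 * i ≤ 9 * j + 1 → 5 * (i + m) ≤ 9 * (j + m) + 1
        five≤nine {i} {j} h = ≤-trans (≤-reflexive (*-distribˡ-+ 5 i m))
          (≤-trans (+-mono-≤ h (*-monoˡ-≤ m (m≤m+n 5 4))) (≤-reflexive (lemma j m)))
          where
          lemma : ∀ j m → 9 * j + 1 + 9 * m ≡ 9 * (j + m) + 1
          lemma = solve-∀

        choose : ∀ x → ℓ + m ≡ x → ∃₂ λ t k → 5 * t ≤ 9 * k + 1 × Pack k (total f) × Cost [] (Covers f) t
        choose zero eq =
          1 + (T + m) , 1 + k , bound {1} {1} (five≤nine {1} {1} (m≤m+n 5 5)) ,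
          union root-triangle (packing none) , cost-ab eq
        -- Two edges against one triangle: 10 = 9 + 1 uses up the additive term. The complete graph
        -- on four vertices attains equality.
        choose (suc zero) eq =
          2 + (T + m) , 1 + k , bound {2} {1} (five≤nine {2} {1} ≤-refl) ,
          one , cost-≤ (≤-reflexive (cong suc (+-suc T m))) (cost-ab eq)
          where
          one : Pack (1 + k) (total f)
          one with some (≤-reflexive (sym eq)) A B (λ ())
          ... | inj₁ x = within {L = A ∷ []} (s≤s z≤n , z≤n , z≤n) x
          ... | inj₂ x = within {L = B ∷ []} (z≤n , s≤s z≤n , z≤n) x
        choose (suc (suc x)) eq =
          let s , t , s≢t , x = pair (subst (2 ≤_) (sym eq) (s≤s (s≤s z≤n))) in
          3 + (T + m) , 2 + k , bound {3} {2} (five≤nine {3} {2} (m≤m+n 15 4)) ,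
          within (two-distinct s t s≢t) x , cost-abc

      -- Faces of a forest and insertion of a vertex.

      data Face : ∀ {a b c} → Forest a b c → V → V → V → Set where
        root : ∀ {a b c} {f : Forest a b c} → Face f a b c
        in₁  : ∀ {a b c u ua ub uc f₁ f₂ f₃ x y z} {g : Forest a b c} →
               Face f₁ x y z → Face (node u ua ub uc f₁ f₂ f₃ g) x y z
        in₂  : ∀ {a b c u ua ub uc f₁ f₂ f₃ x y z} {g : Forest a b c} →
               Face f₂ x y z → Face (node u ua ub uc f₁ f₂ f₃ g) x y z
        in₃  : ∀ {a b c u ua ub uc f₁ f₂ f₃ x y z} {g : Forest a b c} →
               Face f₃ x y z → Face (node u ua ub uc f₁ f₂ f₃ g) x y z
        rest : ∀ {a b c u ua ub uc f₁ f₂ f₃ x y z} {g : Forest a b c} →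
               Face g x y z → Face (node u ua ub uc f₁ f₂ f₃ g) x y z

      covers-face : ∀ {a b c F} {f : Forest a b c} → Covers f F → ∀ {x y z} → Face f x y z → Hit F x y z
      covers-face {f = nil} h root = h
      covers-face {f = node _ _ _ _ _ _ _ _} (_ , q) root = covers-face q root
      covers-face (((q₁ , q₂) , q₃) , q) (in₁ φ) = covers-face q₁ φ
      covers-face (((q₁ , q₂) , q₃) , q) (in₂ φ) = covers-face q₂ φ
      covers-face (((q₁ , q₂) , q₃) , q) (in₃ φ) = covers-face q₃ φ
      covers-face (((q₁ , q₂) , q₃) , q) (rest φ) = covers-face q φ

      module Insertion (v : V) where

        -- The new vertex heads the list of nodes grown on its face, so every older face survives.
        insert : ∀ {a b c x y z} (f : Forest a b c) → Face f x y z →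
                 Adj G v x → Adj G v y → Adj G v z → Forest a b c
        insert f root vx vy vz = node v vx vy vz nil nil nil f
        insert (node u p q r f₁ f₂ f₃ g) (in₁ φ) vx vy vz = node u p q r (insert f₁ φ vx vy vz) f₂ f₃ g
        insert (node u p q r f₁ f₂ f₃ g) (in₂ φ) vx vy vz = node u p q r f₁ (insert f₂ φ vx vy vz) f₃ g
        insert (node u p q r f₁ f₂ f₃ g) (in₃ φ) vx vy vz = node u p q r f₁ f₂ (insert f₃ φ vx vy vz) g
        insert (node u p q r f₁ f₂ f₃ g) (rest φ) vx vy vz = node u p q r f₁ f₂ f₃ (insert g φ vx vy vz)

        module _ {x y z : V} (vx : Adj G v x) (vy : Adj G v y) (vz : Adj G v z) where

          old-face : ∀ {a b c p q r} {f : Forest a b c} (φ : Face f x y z) →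
                     Face f p q r → Face (insert f φ vx vy vz) p q r
          old-face root     ψ        = rest ψ
          old-face (in₁ φ)  root     = root
          old-face (in₁ φ)  (in₁ ψ)  = in₁ (old-face φ ψ)
          old-face (in₁ φ)  (in₂ ψ)  = in₂ ψ
          old-face (in₁ φ)  (in₃ ψ)  = in₃ ψ
          old-face (in₁ φ)  (rest ψ) = rest ψ
          old-face (in₂ φ)  root     = root
          old-face (in₂ φ)  (in₁ ψ)  = in₁ ψ
          old-face (in₂ φ)  (in₂ ψ)  = in₂ (old-face φ ψ)
          old-face (in₂ φ)  (in₃ ψ)  = in₃ ψ
          old-face (in₂ φ)  (rest ψ) = rest ψ
          old-face (in₃ φ)  root     = root
          old-face (in₃ φ)  (in₁ ψ)  = in₁ ψ
          old-face (in₃ φ)  (in₂ ψ)  = in₂ ψ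
          old-face (in₃ φ)  (in₃ ψ)  = in₃ (old-face φ ψ)
          old-face (in₃ φ)  (rest ψ) = rest ψ
          old-face (rest φ) root     = root
          old-face (rest φ) (in₁ ψ)  = in₁ ψ
          old-face (rest φ) (in₂ ψ)  = in₂ ψ
          old-face (rest φ) (in₃ ψ)  = in₃ ψ
          old-face (rest φ) (rest ψ) = rest (old-face φ ψ)

          new-faces : ∀ {a b c} {f : Forest a b c} (φ : Face f x y z) →
            let f′ = insert f φ vx vy vz in Face f′ v y z × Face f′ v x z × Face f′ v x y
          new-faces root     = in₁ root , in₂ root , in₃ root
          new-faces (in₁ φ)  = let p , q , r = new-faces φ in in₁ p , in₁ q , in₁ r
          new-faces (in₂ φ)  = let p , q , r = new-faces φ in in₂ p , in₂ q , in₂ r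
          new-faces (in₃ φ)  = let p , q , r = new-faces φ in in₃ p , in₃ q , in₃ r
          new-faces (rest φ) = let p , q , r = new-faces φ in rest p , rest q , rest r

          insert-supply : ∀ {a b c} {f : Forest a b c} (φ : Face f x y z) u w →
            supply (insert f φ vx vy vz) u w ≡ δ v x u w + (δ v y u w + (δ v z u w + supply f u w))
          insert-supply {f = f} root u w = lemma (δ v x u w) (δ v y u w) (δ v z u w) (supply f u w)
            where
            lemma : ∀ x y z s → x + y + z + (0 + 0 + 0) + s ≡ x + (y + (z + s))
            lemma = solve-∀
          insert-supply {a} {b} {c} {node t _ _ _ f₁ f₂ f₃ g} (in₁ φ) u w =
            trans (cong (λ i → all-sides (star t a b c) u w + (i + supply f₂ u w + supply f₃ u w) + supply g u w)
                        (insert-supply φ u w))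
                  (lemma (δ v x u w) (δ v y u w) (δ v z u w) (all-sides (star t a b c) u w)
                         (supply f₁ u w) (supply f₂ u w) (supply f₃ u w) (supply g u w))
            where
            lemma : ∀ x y z t p q r g →
              t + (x + (y + (z + p)) + q + r) + g ≡ x + (y + (z + (t + (p + q + r) + g)))
            lemma = solve-∀
          insert-supply {a} {b} {c} {node t _ _ _ f₁ f₂ f₃ g} (in₂ φ) u w =
            trans (cong (λ i → all-sides (star t a b c) u w + (supply f₁ u w + i + supply f₃ u w) + supply g u w)
                        (insert-supply φ u w))
                  (lemma (δ v x u w) (δ v y u w) (δ v z u w) (all-sides (star t a b c) u w)
                         (supply f₁ u w) (supply f₂ u w) (supply f₃ u w) (supply g u w))
            where
            lemma : ∀ x y z t p q r g →
              t + (p + (x + (y + (z + q))) + r) + g ≡ x + (y + (z + (t + (p + q + r) + g)))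
            lemma = solve-∀
          insert-supply {a} {b} {c} {node t _ _ _ f₁ f₂ f₃ g} (in₃ φ) u w =
            trans (cong (λ i → all-sides (star t a b c) u w + (supply f₁ u w + supply f₂ u w + i) + supply g u w)
                        (insert-supply φ u w))
                  (lemma (δ v x u w) (δ v y u w) (δ v z u w) (all-sides (star t a b c) u w)
                         (supply f₁ u w) (supply f₂ u w) (supply f₃ u w) (supply g u w))
            where
            lemma : ∀ x y z t p q r g →
              t + (p + q + (x + (y + (z + r)))) + g ≡ x + (y + (z + (t + (p + q + r) + g)))
            lemma = solve-∀
          insert-supply {a} {b} {c} {node t _ _ _ f₁ f₂ f₃ g} (rest φ) u w =
            trans (cong (λ i → all-sides (star t a b c) u w + (supply f₁ u w + supply f₂ u w + supply f₃ u w) + i)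
                        (insert-supply φ u w))
                  (lemma (δ v x u w) (δ v y u w) (δ v z u w) (all-sides (star t a b c) u w)
                         (supply f₁ u w + supply f₂ u w + supply f₃ u w) (supply g u w))
            where
            lemma : ∀ x y z t f g → t + f + (x + (y + (z + g))) ≡ x + (y + (z + (t + f + g)))
            lemma = solve-∀

  -- Sums of indicators and triples up to order.

  ⟦⟧-false : ∀ {P : Set} (d : Dec P) → ¬ P → ⟦ d ⟧ ≡ 0
  ⟦⟧-false (yes p) ¬p = ⊥-elim (¬p p)
  ⟦⟧-false (no  _) _  = refl

  -- Peels off one edge at a time when showing that no edge is supplied twice: the remaining count
  -- has to vanish only where the indicator is one.
  ⟦⟧+≤1 : ∀ {P : Set} {n} (d : Dec P) → (P → n ≡ 0) → n ≤ 1 → ⟦ d ⟧ + n ≤ 1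
  ⟦⟧+≤1 (yes p) h _   = s≤s (≤-reflexive (h p))
  ⟦⟧+≤1 (no  _) _ n≤1 = n≤1

  infix 4 _∈₃_

  _∈₃_ : ∀ {X : Set} → X → X × X × X → Set
  i ∈₃ (x , y , z) = i ≡ x ⊎ i ≡ y ⊎ i ≡ z

  pattern 1st = inj₁ refl
  pattern 2nd = inj₂ (inj₁ refl)
  pattern 3rd = inj₂ (inj₂ refl)

  -- Three different elements occupy three different positions, hence all of them.
  onto : ∀ {X : Set} {i j k x y z : X} → i ≢ j → i ≢ k → j ≢ k →
         i ∈₃ (x , y , z) → j ∈₃ (x , y , z) → k ∈₃ (x , y , z) →
         x ∈₃ (i , j , k) × y ∈₃ (i , j , k) × z ∈₃ (i , j , k)
  onto i≢j i≢k j≢k 1st 1st _   = ⊥-elim (i≢j refl)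
  onto i≢j i≢k j≢k 2nd 2nd _   = ⊥-elim (i≢j refl)
  onto i≢j i≢k j≢k 3rd 3rd _   = ⊥-elim (i≢j refl)
  onto i≢j i≢k j≢k 1st 2nd 1st = ⊥-elim (i≢k refl)
  onto i≢j i≢k j≢k 1st 2nd 2nd = ⊥-elim (j≢k refl)
  onto i≢j i≢k j≢k 1st 2nd 3rd = 1st , 2nd , 3rd
  onto i≢j i≢k j≢k 1st 3rd 1st = ⊥-elim (i≢k refl)
  onto i≢j i≢k j≢k 1st 3rd 2nd = 1st , 3rd , 2nd
  onto i≢j i≢k j≢k 1st 3rd 3rd = ⊥-elim (j≢k refl)
  onto i≢j i≢k j≢k 2nd 1st 1st = ⊥-elim (j≢k refl)
  onto i≢j i≢k j≢k 2nd 1st 2nd = ⊥-elim (i≢k refl)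
  onto i≢j i≢k j≢k 2nd 1st 3rd = 2nd , 1st , 3rd
  onto i≢j i≢k j≢k 2nd 3rd 1st = 3rd , 1st , 2nd
  onto i≢j i≢k j≢k 2nd 3rd 2nd = ⊥-elim (i≢k refl)
  onto i≢j i≢k j≢k 2nd 3rd 3rd = ⊥-elim (j≢k refl)
  onto i≢j i≢k j≢k 3rd 1st 1st = ⊥-elim (j≢k refl)
  onto i≢j i≢k j≢k 3rd 1st 2nd = 2nd , 3rd , 1st
  onto i≢j i≢k j≢k 3rd 1st 3rd = ⊥-elim (i≢k refl)
  onto i≢j i≢k j≢k 3rd 2nd 1st = 3rd , 2nd , 1st
  onto i≢j i≢k j≢k 3rd 2nd 2nd = ⊥-elim (j≢k refl)
  onto i≢j i≢k j≢k 3rd 2nd 3rd = ⊥-elim (i≢k refl)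

  -- Every 3-tree is a forest grown on its first triangle.

  module Growth {N : ℕ} (G : Graph N) where
    open Forests G

    adj-≢ : ∀ {x y} → Adj G x y → x ≢ y
    adj-≢ xy refl = irrefl G refl xy

    face-triangle : ∀ {a b c x y z} {f : Forest a b c} → IsTriangle G (a , b , c) →
                    Face f x y z → IsTriangle G (x , y , z)
    face-triangle abc root = abc
    face-triangle (ab , ac , bc) (in₁ {ub = ub} {uc = uc} φ) = face-triangle (ub , uc , bc) φ
    face-triangle (ab , ac , bc) (in₂ {ua = ua} {uc = uc} φ) = face-triangle (ua , uc , ac) φ
    face-triangle (ab , ac , bc) (in₃ {ua = ua} {ub = ub} φ) = face-triangle (ua , ub , ab) φ
    face-triangle abc (rest φ) = face-triangle abc φ

    same-ends : ∀ {x y x′ y′ u w : Fin N} → SameEdge x y u w → SameEdge x′ y′ u w →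
                (x ≡ x′ × y ≡ y′) ⊎ (x ≡ y′ × y ≡ x′)
    same-ends (inj₁ (refl , refl)) (inj₁ (refl , refl)) = inj₁ (refl , refl)
    same-ends (inj₁ (refl , refl)) (inj₂ (refl , refl)) = inj₂ (refl , refl)
    same-ends (inj₂ (refl , refl)) (inj₁ (refl , refl)) = inj₂ (refl , refl)
    same-ends (inj₂ (refl , refl)) (inj₂ (refl , refl)) = inj₁ (refl , refl)

    -- A `Face` lists its vertices in the order given by the forest, so containment is asked up to
    -- order.
    Holds : ∀ {n a b c} → Forest a b c → (Fin n → Fin N) → Fin n → Fin n → Fin n → Set
    Holds f σ i j k = ∃ λ x → ∃₂ λ y z → Face f x y z ×
      σ i ∈₃ (x , y , z) × σ j ∈₃ (x , y , z) × σ k ∈₃ (x , y , z)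

    -- The forest lives in the final graph at every stage, and `σ` places the current vertices
    -- there. The field `fresh` keeps `once` true in the next step: a vertex not yet placed has no
    -- supplied edge.
    record Grown {n} (H : Graph n) (σ : Fin n → Fin N) : Set where
      field
        {a b c}  : Fin N
        abc      : IsTriangle G (a , b , c)
        forest   : Forest a b c
        exhaustive : ∀ i j k → IsTriangle H (i , j , k) → Holds forest σ i j k
        once     : ∀ u w → total forest u w ≤ 1
        fresh    : ∀ v → (∀ i → v ≢ σ i) → ∀ w → total forest v w ≡ 0 × total forest w v ≡ 0

    grow-base : ∀ σ → (∀ {i j} → i ≢ j → Adj G (σ i) (σ j)) → Grown (complete 3) σ
    grow-base σ σ-adj = record
      { abc      = ab , ac , bc
      ; forest   = nil
      ; exhaustive = λ i j k _ → _ , _ , _ , root , in-base i , in-base j , in-base k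
      -- Two sides with the same ends would identify two vertices of the triangle.
      ; once     = λ u w → ≤-trans (≤-reflexive (flatten u w))
          (⟦⟧+≤1 (sameEdge? b c u w) (λ p → cong₂ _+_
                   (⟦⟧-false (sameEdge? a c u w) (λ q → case same-ends p q of λ where
                     (inj₁ (b≡a , _)) → adj-≢ ab (sym b≡a)
                     (inj₂ (b≡c , _)) → adj-≢ bc b≡c))
                   (cong (_+ 0) (⟦⟧-false (sameEdge? a b u w) (λ q → case same-ends p q of λ where
                     (inj₁ (b≡a , _)) → adj-≢ ab (sym b≡a)
                     (inj₂ (_ , c≡a)) → adj-≢ ac (sym c≡a)))))
            (⟦⟧+≤1 (sameEdge? a c u w) (λ p →
                   cong (_+ 0) (⟦⟧-false (sameEdge? a b u w) (λ q → case same-ends p q of λ where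
                     (inj₁ (_ , c≡b)) → adj-≢ bc (sym c≡b)
                     (inj₂ (a≡b , _)) → adj-≢ ab a≡b)))
              (⟦⟧+≤1 (sameEdge? a b u w) (λ _ → refl) z≤n)))
      ; fresh    = λ v v∉ w → absent v v∉ w , absent′ v v∉ w
      }
      where
      a b c : Fin N
      a = σ zero
      b = σ (suc zero)
      c = σ (suc (suc zero))
      ab : Adj G a b
      ab = σ-adj λ ()
      ac : Adj G a c
      ac = σ-adj λ ()
      bc : Adj G b c
      bc = σ-adj λ ()
      in-base : ∀ i → σ i ∈₃ (a , b , c)
      in-base zero             = 1st
      in-base (suc zero)       = 2nd
      in-base (suc (suc zero)) = 3rd
      flatten : ∀ u w → total {a} {b} {c} nil u w ≡ δ b c u w + (δ a c u w + (δ a b u w + 0))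
      flatten u w = lemma (δ b c u w) (δ a c u w) (δ a b u w)
        where
        lemma : ∀ x y z → x + y + z + 0 ≡ x + (y + (z + 0))
        lemma = solve-∀
      module _ (v : Fin N) (v∉ : ∀ i → v ≢ σ i) (w : Fin N) where
        miss : ∀ i j → δ (σ i) (σ j) v w ≡ 0
        miss i j = ⟦⟧-false (sameEdge? (σ i) (σ j) v w) λ where
          (inj₁ (e , _)) → v∉ i (sym e)
          (inj₂ (_ , e)) → v∉ j (sym e)
        miss′ : ∀ i j → δ (σ i) (σ j) w v ≡ 0
        miss′ i j = ⟦⟧-false (sameEdge? (σ i) (σ j) w v) λ where
          (inj₁ (_ , e)) → v∉ j (sym e)
          (inj₂ (e , _)) → v∉ i (sym e)
        absent : total {a} {b} {c} nil v w ≡ 0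
        absent = cong (_+ 0) (cong₂ _+_ (cong₂ _+_ (miss _ _) (miss _ _)) (miss _ _))
        absent′ : total {a} {b} {c} nil w v ≡ 0
        absent′ = cong (_+ 0) (cong₂ _+_ (cong₂ _+_ (miss′ _ _) (miss′ _ _)) (miss′ _ _))

    grow-step : ∀ {n} {H : Graph n} {p q r} (σ : Fin (ℕ.suc n) → Fin N) →
                (∀ {i j} → i ≢ j → σ i ≢ σ j) →
                (∀ {i j} → Adj (stack H p q r) i j → Adj G (σ i) (σ j)) →
                IsTriangle H (p , q , r) → Grown H (σ ∘ suc) → Grown (stack H p q r) σ
    grow-step {n} {H} {p} {q} {r} σ σ-inj σ-adj pqr@(pq , pr , qr) grown
      -- The chosen triangle is a face of the forest, and the new vertex is inserted there.
      with Grown.exhaustive grown p q r pqr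
    ... | x , y , z , φ , p∈ , q∈ , r∈ = record
      { abc      = abc
      ; forest   = forest′
      ; exhaustive = exhaustive′
      -- The three new edges differ in their ends other than v, and no older edge contains v.
      ; once     = λ u w → ≤-trans (≤-reflexive (total-insert u w))
          (⟦⟧+≤1 (sameEdge? v x u w)
            (λ s → cong₂ _+_ (apart vx x≢y u w s) (cong₂ _+_ (apart vx x≢z u w s) (spent s)))
            (⟦⟧+≤1 (sameEdge? v y u w)
              (λ s → cong₂ _+_ (apart vy y≢z u w s) (spent s))
              (⟦⟧+≤1 (sameEdge? v z u w) spent (once u w))))
      ; fresh    = λ v′ v′∉ w →
          trans (total-insert v′ w) (cong₂ _+_ (miss v′ v′∉ x∈ w) (cong₂ _+_ (miss v′ v′∉ y∈ w)
            (cong₂ _+_ (miss v′ v′∉ z∈ w) (proj₁ (fresh v′ (v′∉ ∘ suc) w))))) ,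
          trans (total-insert w v′) (cong₂ _+_ (miss′ v′ v′∉ x∈ w) (cong₂ _+_ (miss′ v′ v′∉ y∈ w)
            (cong₂ _+_ (miss′ v′ v′∉ z∈ w) (proj₂ (fresh v′ (v′∉ ∘ suc) w)))))
      }
      where
      open Grown grown
      v : Fin N
      v = σ zero
      open Insertion v

      old-adj : ∀ {i j} → Adj H i j → Adj G (σ (suc i)) (σ (suc j))
      old-adj = σ-adj

      xyz : x ∈₃ (σ (suc p) , σ (suc q) , σ (suc r)) × y ∈₃ (σ (suc p) , σ (suc q) , σ (suc r))
          × z ∈₃ (σ (suc p) , σ (suc q) , σ (suc r))
      xyz = onto (adj-≢ (old-adj pq)) (adj-≢ (old-adj pr)) (adj-≢ (old-adj qr)) p∈ q∈ r∈

      x∈ : x ∈₃ (σ (suc p) , σ (suc q) , σ (suc r))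
      x∈ = proj₁ xyz
      y∈ : y ∈₃ (σ (suc p) , σ (suc q) , σ (suc r))
      y∈ = proj₁ (proj₂ xyz)
      z∈ : z ∈₃ (σ (suc p) , σ (suc q) , σ (suc r))
      z∈ = proj₂ (proj₂ xyz)

      joined : ∀ {t} → t ∈₃ (σ (suc p) , σ (suc q) , σ (suc r)) → Adj G v t
      joined 1st = σ-adj {zero} {suc p} 1st
      joined 2nd = σ-adj {zero} {suc q} 2nd
      joined 3rd = σ-adj {zero} {suc r} 3rd

      vx : Adj G v x
      vx = joined x∈
      vy : Adj G v y
      vy = joined y∈
      vz : Adj G v z
      vz = joined z∈

      x≢y : x ≢ y
      x≢y = adj-≢ (proj₁ (face-triangle abc φ))
      x≢z : x ≢ z
      x≢z = adj-≢ (proj₁ (proj₂ (face-triangle abc φ)))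
      y≢z : y ≢ z
      y≢z = adj-≢ (proj₂ (proj₂ (face-triangle abc φ)))

      forest′ : Forest a b c
      forest′ = insert forest φ vx vy vz

      total-insert : ∀ u w → total forest′ u w ≡ δ v x u w + (δ v y u w + (δ v z u w + total forest u w))
      total-insert u w = trans (cong (all-sides (face a b c) u w +_) (insert-supply vx vy vz φ u w))
        (lemma (all-sides (face a b c) u w) (δ v x u w) (δ v y u w) (δ v z u w) (supply forest u w))
        where
        lemma : ∀ f x y z s → f + (x + (y + (z + s))) ≡ x + (y + (z + (f + s)))
        lemma = solve-∀

      apart : ∀ {s t} → Adj G v s → s ≢ t → ∀ u w → SameEdge v s u w → δ v t u w ≡ 0
      apart {s} {t} vs s≢t u w e = ⟦⟧-false (sameEdge? v t u w) λ e′ → case same-ends e e′ of λ where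
        (inj₁ (_ , s≡t)) → s≢t s≡t
        (inj₂ (_ , s≡v)) → adj-≢ vs (sym s≡v)

      v-fresh : ∀ w → total forest v w ≡ 0 × total forest w v ≡ 0
      v-fresh = fresh v λ i → σ-inj λ ()

      spent : ∀ {s u w} → SameEdge v s u w → total forest u w ≡ 0
      spent (inj₁ (refl , _)) = proj₁ (v-fresh _)
      spent (inj₂ (refl , _)) = proj₂ (v-fresh _)

      outside : ∀ {v′ t} → (∀ i → v′ ≢ σ i) → t ∈₃ (σ (suc p) , σ (suc q) , σ (suc r)) → t ≢ v′
      outside v′∉ 1st e = v′∉ _ (sym e)
      outside v′∉ 2nd e = v′∉ _ (sym e)
      outside v′∉ 3rd e = v′∉ _ (sym e)

      miss : ∀ v′ → (∀ i → v′ ≢ σ i) → ∀ {t} → t ∈₃ (σ (suc p) , σ (suc q) , σ (suc r)) → ∀ w → δ v t v′ w ≡ 0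
      miss v′ v′∉ {t} t∈ w = ⟦⟧-false (sameEdge? v t v′ w) λ where
        (inj₁ (e , _)) → v′∉ zero (sym e)
        (inj₂ (_ , e)) → outside v′∉ t∈ e

      miss′ : ∀ v′ → (∀ i → v′ ≢ σ i) → ∀ {t} → t ∈₃ (σ (suc p) , σ (suc q) , σ (suc r)) → ∀ w → δ v t w v′ ≡ 0
      miss′ v′ v′∉ {t} t∈ w = ⟦⟧-false (sameEdge? v t w v′) λ where
        (inj₁ (_ , e)) → outside v′∉ t∈ e
        (inj₂ (e , _)) → v′∉ zero (sym e)

      chosen∈ : ∀ {i} → Chosen H p q r i → σ (suc i) ∈₃ (x , y , z)
      chosen∈ 1st = p∈
      chosen∈ 2nd = q∈
      chosen∈ 3rd = r∈

      New : Fin N → Fin N → Set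
      New s t = ∃ λ x → ∃₂ λ y z → Face forest′ x y z × v ∈₃ (x , y , z) × s ∈₃ (x , y , z) × t ∈₃ (x , y , z)

      -- The vertices s and t miss at least one of x, y, z; the new face without that one contains
      -- both.
      new : ∀ {s t} → s ∈₃ (x , y , z) → t ∈₃ (x , y , z) → New s t
      new s∈ t∈ with new-faces vx vy vz φ
      new 1st 1st | ψ₁ , ψ₂ , ψ₃ = _ , _ , _ , ψ₃ , 1st , 2nd , 2nd
      new 1st 2nd | ψ₁ , ψ₂ , ψ₃ = _ , _ , _ , ψ₃ , 1st , 2nd , 3rd
      new 1st 3rd | ψ₁ , ψ₂ , ψ₃ = _ , _ , _ , ψ₂ , 1st , 2nd , 3rd
      new 2nd 1st | ψ₁ , ψ₂ , ψ₃ = _ , _ , _ , ψ₃ , 1st , 3rd , 2nd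
      new 2nd 2nd | ψ₁ , ψ₂ , ψ₃ = _ , _ , _ , ψ₃ , 1st , 3rd , 3rd
      new 2nd 3rd | ψ₁ , ψ₂ , ψ₃ = _ , _ , _ , ψ₁ , 1st , 2nd , 3rd
      new 3rd 1st | ψ₁ , ψ₂ , ψ₃ = _ , _ , _ , ψ₂ , 1st , 3rd , 2nd
      new 3rd 2nd | ψ₁ , ψ₂ , ψ₃ = _ , _ , _ , ψ₁ , 1st , 3rd , 2nd
      new 3rd 3rd | ψ₁ , ψ₂ , ψ₃ = _ , _ , _ , ψ₂ , 1st , 3rd , 3rd

      exhaustive′ : ∀ i j k → IsTriangle (stack H p q r) (i , j , k) → Holds forest′ σ i j k
      exhaustive′ (suc i) (suc j) (suc k) t =
        let _ , _ , _ , ψ , i∈ , j∈ , k∈ = exhaustive i j k t in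
        _ , _ , _ , old-face vx vy vz φ ψ , i∈ , j∈ , k∈
      -- A triangle through the new vertex has its other two vertices among the chosen three.
      exhaustive′ zero (suc j) (suc k) (j∈ , k∈ , _) =
        let _ , _ , _ , ψ , v∈ , s∈ , t∈ = new (chosen∈ j∈) (chosen∈ k∈) in _ , _ , _ , ψ , v∈ , s∈ , t∈
      exhaustive′ (suc i) zero (suc k) (i∈ , _ , k∈) =
        let _ , _ , _ , ψ , v∈ , s∈ , t∈ = new (chosen∈ i∈) (chosen∈ k∈) in _ , _ , _ , ψ , s∈ , v∈ , t∈
      exhaustive′ (suc i) (suc j) zero (_ , i∈ , j∈) =
        let _ , _ , _ , ψ , v∈ , s∈ , t∈ = new (chosen∈ i∈) (chosen∈ j∈) in _ , _ , _ , ψ , s∈ , t∈ , v∈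
      exhaustive′ zero    zero    _       (() , _)
      exhaustive′ zero    (suc _) zero    (_ , () , _)
      exhaustive′ (suc _) zero    zero    (_ , _ , ())

    grow : ∀ {n} {H : Graph n} → Stacked H → (σ : Fin n → Fin N) → (∀ {i j} → i ≢ j → σ i ≢ σ j) →
           (∀ {i j} → Adj H i j → Adj G (σ i) (σ j)) → Grown H σ
    grow base             σ σ-inj σ-adj = grow-base σ σ-adj
    grow (step h p q r t) σ σ-inj σ-adj =
      grow-step σ σ-inj σ-adj t (grow h (σ ∘ suc) (λ i≢j → σ-inj (i≢j ∘ suc-injective)) σ-adj)

    -- The inverse numbering places the stacked graph inside G. It reaches every vertex, so
    -- freshness becomes vacuous.
    grow-3tree : Is3Tree G → Grown G (λ i → i)
    grow-3tree (H , h , π , iso) = record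
      { Grown grown hiding (exhaustive; fresh)
      ; exhaustive = λ i j k (ij , ik , jk) →
          let x , y , z , φ , i∈ , j∈ , k∈ = exhaustive _ _ _ (to ij , to ik , to jk) in
          x , y , z , φ , back i∈ , back j∈ , back k∈
      ; fresh = λ v v∉ → ⊥-elim (v∉ v refl)
      }
      where
      σ : Fin N → Fin N
      σ = π ⟨$⟩ˡ_
      back : ∀ {i t} → σ (π ⟨$⟩ʳ i) ∈₃ t → i ∈₃ t
      back {t = t} = subst (_∈₃ t) (inverseˡ π)
      to : ∀ {i j} → Adj G i j → Adj H (π ⟨$⟩ʳ i) (π ⟨$⟩ʳ j)
      to {i} {j} = Equivalence.to (iso i j)
      σ-inj : ∀ {i j} → i ≢ j → σ i ≢ σ j
      σ-inj i≢j e = i≢j (trans (sym (inverseʳ π)) (trans (cong (π ⟨$⟩ʳ_) e) (inverseʳ π)))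
      σ-adj : ∀ {i j} → Adj H i j → Adj G (σ i) (σ j)
      σ-adj {i} {j} ij = Equivalence.from (iso (σ i) (σ j)) (subst₂ (Adj H) (sym (inverseʳ π)) (sym (inverseʳ π)) ij)
      grown : Grown H σ
      grown = grow h σ σ-inj σ-adj
      open Grown grown using (exhaustive)

  -- Sublists and lists without repetitions.

  filter∈sublists : ∀ {X : Set} {P : X → Set} (P? : Decidable P) xs → filter P? xs ∈ sublists xs
  filter∈sublists P? []       = here refl
  filter∈sublists P? (x ∷ xs) with P? x
  ... | yes _ = ∈-++⁺ˡ (∈-map⁺ (x ∷_) (filter∈sublists P? xs))
  ... | no  _ = ∈-++⁺ʳ (map (x ∷_) (sublists xs)) (filter∈sublists P? xs)

  -- Cutting the head of `xs` out of `ys` keeps the rest of `xs` inside, since the head does not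
  -- recur.
  Unique-⊆-length : ∀ {X : Set} {xs ys : List X} → Unique xs → xs ⊆ ys → length xs ≤ length ys
  Unique-⊆-length {xs = []}     _        _ = z≤n
  Unique-⊆-length {xs = x ∷ xs} (x∉ ∷ u) s with ∈-∃++ (s (here refl))
  ... | ys , zs , refl = ≤-trans (s≤s (Unique-⊆-length u s′)) (≤-reflexive len)
    where
    s′ : xs ⊆ ys ++ zs
    s′ {y} y∈ with ∈-++⁻ ys (s (there y∈))
    ... | inj₁ y∈ys         = ∈-++⁺ˡ y∈ys
    ... | inj₂ (here refl)  = ⊥-elim (All.lookup x∉ y∈ refl)
    ... | inj₂ (there y∈zs) = ∈-++⁺ʳ ys y∈zs
    len : ℕ.suc (length (ys ++ zs)) ≡ length (ys ++ x ∷ zs)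
    len = trans (cong ℕ.suc (length-++ ys)) (trans (sym (+-suc (length ys) (length zs))) (sym (length-++ ys)))

  AllPairs-lookup : ∀ {X : Set} {R : X → X → Set} {xs x y} → Symmetric R → AllPairs R xs →
                    x ∈ xs → y ∈ xs → x ≢ y → R x y
  AllPairs-lookup R-sym (r ∷ _)  (here refl) (here refl) x≢y = ⊥-elim (x≢y refl)
  AllPairs-lookup R-sym (r ∷ _)  (here refl) (there y∈)  x≢y = All.lookup r y∈
  AllPairs-lookup R-sym (r ∷ _)  (there x∈)  (here refl) x≢y = R-sym (All.lookup r x∈)
  AllPairs-lookup R-sym (_ ∷ rs) (there x∈)  (there y∈)  x≢y = AllPairs-lookup R-sym rs x∈ y∈ x≢y

  -- Two members of `xs` may occur in `ys` in the opposite order, hence the symmetry; uniqueness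
  -- excludes pairing an element with itself.
  AllPairs-⊆ : ∀ {X : Set} {R : X → X → Set} {xs ys} → Symmetric R → Unique xs → xs ⊆ ys →
               AllPairs R ys → AllPairs R xs
  AllPairs-⊆ {xs = []}     R-sym _        _ _ = []
  AllPairs-⊆ {xs = x ∷ xs} R-sym (x∉ ∷ u) s r =
    All.tabulate (λ y∈ → AllPairs-lookup R-sym r (s (here refl)) (s (there y∈)) (All.lookup x∉ y∈))
    ∷ AllPairs-⊆ R-sym u (s ∘ there) r

  -- From packings and deleted edges to the two graph parameters.

  module Parameters {N : ℕ} (G : Graph N) where
    open Forests G
    open Packings G
    open Growth G

    Triple : Set
    Triple = Fin N × Fin N × Fin N

    open DecMembership (_≟ₑ_ {N}) using () renaming (_∈?_ to _∈ₑ?_)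
    open DecMembership (≡-dec (_≟_ {N}) (_≟ₑ_ {N})) using () renaming (_∈?_ to _∈ₜ?_)

    Disjoint-sym : Symmetric (EdgeDisjoint {N})
    Disjoint-sym d (p , q) = d (q , p)

    -- The parameter `ν` sees only increasing triples, whereas packings hold triangles in any order.
    record Sorted (x y z : Fin N) : Set where
      constructor sorted
      field
        triple : Triple
        listed : triple ∈ triangles G
        edges≡ : ∀ {u w} → (u , w) ∈ triangleEdges triple →
                 SameEdge x y u w ⊎ SameEdge x z u w ⊎ SameEdge y z u w

    ∈-triangles : ∀ {i j k} → i Fin.< j → j Fin.< k → IsTriangle G (i , j , k) → (i , j , k) ∈ triangles G
    ∈-triangles i<j j<k t = ∈-filter⁺ _
      (∈-cartesianProduct⁺ (∈-allFin _) (∈-cartesianProduct⁺ (∈-allFin _) (∈-allFin _))) (i<j , j<k , t)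

    sort : ∀ {x y z} → IsTriangle G (x , y , z) → Sorted x y z
    sort {x} {y} {z} (xy , xz , yz) with Fin.<-cmp x y | Fin.<-cmp x z | Fin.<-cmp y z
    ... | tri≈ _ x≡y _ | _ | _ = ⊥-elim (adj-≢ xy x≡y)
    ... | _ | tri≈ _ x≡z _ | _ = ⊥-elim (adj-≢ xz x≡z)
    ... | _ | _ | tri≈ _ y≡z _ = ⊥-elim (adj-≢ yz y≡z)
    ... | tri< x<y _ _ | tri< x<z _ _ | tri< y<z _ _ =
      sorted _ (∈-triangles x<y y<z (xy , xz , yz)) λ where
        (here refl)                 → inj₁ (inj₁ (refl , refl))
        (there (here refl))         → inj₂ (inj₁ (inj₁ (refl , refl)))
        (there (there (here refl))) → inj₂ (inj₂ (inj₁ (refl , refl)))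
    ... | tri< x<y _ _ | tri< x<z _ _ | tri> _ _ z<y =
      sorted _ (∈-triangles x<z z<y (xz , xy , symm G yz)) λ where
        (here refl)                 → inj₂ (inj₁ (inj₁ (refl , refl)))
        (there (here refl))         → inj₁ (inj₁ (refl , refl))
        (there (there (here refl))) → inj₂ (inj₂ (inj₂ (refl , refl)))
    -- Of the eight outcomes, this one and its reverse are cyclic and cannot occur.
    ... | tri< x<y _ _ | tri> _ _ z<x | tri< y<z _ _ =
      ⊥-elim (Fin.<-irrefl refl (Fin.<-trans (Fin.<-trans x<y y<z) z<x))
    ... | tri< x<y _ _ | tri> _ _ z<x | tri> _ _ z<y =
      sorted _ (∈-triangles z<x x<y (symm G xz , symm G yz , xy)) λ where
        (here refl)                 → inj₂ (inj₁ (inj₂ (refl , refl)))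
        (there (here refl))         → inj₂ (inj₂ (inj₂ (refl , refl)))
        (there (there (here refl))) → inj₁ (inj₁ (refl , refl))
    ... | tri> _ _ y<x | tri< x<z _ _ | tri< y<z _ _ =
      sorted _ (∈-triangles y<x x<z (symm G xy , yz , xz)) λ where
        (here refl)                 → inj₁ (inj₂ (refl , refl))
        (there (here refl))         → inj₂ (inj₂ (inj₁ (refl , refl)))
        (there (there (here refl))) → inj₂ (inj₁ (inj₁ (refl , refl)))
    ... | tri> _ _ y<x | tri< x<z _ _ | tri> _ _ z<y =
      ⊥-elim (Fin.<-irrefl refl (Fin.<-trans (Fin.<-trans x<z z<y) y<x))
    ... | tri> _ _ y<x | tri> _ _ z<x | tri< y<z _ _ =
      sorted _ (∈-triangles y<z z<x (yz , symm G xy , symm G xz)) λ where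
        (here refl)                 → inj₂ (inj₂ (inj₁ (refl , refl)))
        (there (here refl))         → inj₁ (inj₂ (refl , refl))
        (there (there (here refl))) → inj₂ (inj₁ (inj₂ (refl , refl)))
    ... | tri> _ _ y<x | tri> _ _ z<x | tri> _ _ z<y =
      sorted _ (∈-triangles z<y y<x (symm G yz , symm G xz , symm G xy)) λ where
        (here refl)                 → inj₂ (inj₂ (inj₂ (refl , refl)))
        (there (here refl))         → inj₂ (inj₁ (inj₂ (refl , refl)))
        (there (there (here refl))) → inj₁ (inj₂ (refl , refl))

    δ-same : ∀ {x y u w : Fin N} → SameEdge x y u w → 1 ≤ δ x y u w
    δ-same {x} {y} {u} {w} s with sameEdge? x y u w
    ... | yes _ = ≤-refl
    ... | no ¬s = ⊥-elim (¬s s)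

    loaded : ∀ {x y z u w : Fin N} → SameEdge x y u w ⊎ SameEdge x z u w ⊎ SameEdge y z u w →
             1 ≤ (δ x y ⊕ δ x z ⊕ δ y z) u w
    loaded (inj₁ s)        = ≤-trans (δ-same s) (≤-trans (m≤m+n _ _) (m≤m+n _ _))
    loaded {x} {y} {u = u} {w} (inj₂ (inj₁ s)) = ≤-trans (δ-same s) (≤-trans (m≤n+m _ (δ x y u w)) (m≤m+n _ _))
    loaded (inj₂ (inj₂ s)) = ≤-trans (δ-same s) (m≤n+m _ _)

    record SortedFamily (P : List Triple) : Set where
      field
        family   : List Triple
        size     : length family ≡ length P
        listed   : family ⊆ triangles G
        disjoint : AllPairs EdgeDisjoint family
        used     : ∀ {t u w} → t ∈ family → (u , w) ∈ triangleEdges t → 1 ≤ load P u w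

    sort-family : ∀ P → All (IsTriangle G) P → (∀ u w → load P u w ≤ 1) → SortedFamily P
    sort-family [] _ _ = record { family = [] ; size = refl ; listed = λ () ; disjoint = [] ; used = λ () }
    sort-family ((x , y , z) ∷ P) (t ∷ ts) h = record
      { family   = triple ∷ family
      ; size     = cong ℕ.suc size
      ; listed   = λ { (here refl) → t∈ ; (there s) → listed s }
      -- A shared edge would be loaded at least twice, against `h`.
      ; disjoint = All.tabulate (λ s∈ {e} (p , q) → <-irrefl refl
                     (≤-trans (+-mono-≤ (loaded {x} {y} {z} (edges≡ p)) (used s∈ q)) (h _ _)))
                   ∷ disjoint
      ; used     = λ { (here refl) p → ≤-trans (loaded {x} {y} {z} (edges≡ p)) (m≤m+n _ _)
                     ; (there s) p → ≤-trans (used s p) (m≤n+m _ _) }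
      }
      where
      open Sorted (sort t) using (triple; edges≡) renaming (listed to t∈)
      open SortedFamily (sort-family P ts (λ u w → ≤-trans (m≤n+m _ _) (h u w)))

    triangles-unique : Unique (triangles G)
    triangles-unique = Unique.filter⁺ _ (Unique.cartesianProduct⁺ (Unique.allFin⁺ N)
      (Unique.cartesianProduct⁺ (Unique.allFin⁺ N) (Unique.allFin⁺ N)))

    edges-unique : Unique (edges G)
    edges-unique = Unique.filter⁺ _ (Unique.cartesianProduct⁺ (Unique.allFin⁺ N) (Unique.allFin⁺ N))

    family-unique : ∀ {P} → AllPairs (EdgeDisjoint {N}) P → Unique P
    family-unique = AllPairs.map λ { d refl → d (here refl , here refl) }

    -- The candidates for `ν` are sublists in the order of `triangles G`, so the sorted family is
    -- replaced by the sublist of its members, which is at least as long.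
    ν-bound : ∀ {k R} → (∀ u w → R u w ≤ 1) → Pack k R → k ≤ ν G
    ν-bound R≤1 (pack P k≤ v f) = ≤-trans k≤ (≤-trans (≤-reflexive (sym size))
      (≤-trans (Unique-⊆-length (family-unique disjoint) (λ t∈ → ∈-filter⁺ (_∈ₜ? family) (listed t∈) t∈))
      (All.lookup (xs≤max 0 _) (∈-map⁺ length (∈-filter⁺ (allPairs? edgeDisjoint?)
        (filter∈sublists (_∈ₜ? family) (triangles G))
        (AllPairs-⊆ Disjoint-sym (Unique.filter⁺ (_∈ₜ? family) triangles-unique)
          (λ t∈ → proj₂ (∈-filter⁻ (_∈ₜ? family) {xs = triangles G} t∈)) disjoint))))))
      where
      open SortedFamily (sort-family P v (λ u w → ≤-trans (f u w) (R≤1 u w)))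

    increasing : Fin N × Fin N → Fin N × Fin N
    increasing (i , j) with i <? j
    ... | yes _ = i , j
    ... | no  _ = j , i

    increasing-< : ∀ {i j} → i Fin.< j → increasing (i , j) ≡ (i , j) × increasing (j , i) ≡ (i , j)
    increasing-< {i} {j} i<j with i <? j | j <? i
    ... | no i≮j | _       = ⊥-elim (i≮j i<j)
    ... | yes _  | yes j<i = ⊥-elim (Fin.<-asym i<j j<i)
    ... | yes _  | no _    = refl , refl

    -- The list `F` may hold reversed, repeated or non-adjacent pairs. The edges of G that it
    -- deletes form a sublist `L` of `edges G` that is no longer than `F`.
    τ-bound : ∀ F → (∀ i j k → IsTriangle G (i , j , k) → Hit F i j k) → τ G ≤ length F
    τ-bound F h = ≤-trans
      (All.lookup (min≤xs _ _) (∈-map⁺ length (∈-filter⁺ (λ F → triangleFree? (G − F))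
        (filter∈sublists (_∈ₑ? F′) (edges G)) free)))
      (≤-trans (Unique-⊆-length (Unique.filter⁺ (_∈ₑ? F′) edges-unique)
                  (λ e∈ → proj₂ (∈-filter⁻ (_∈ₑ? F′) {xs = edges G} e∈)))
               (≤-reflexive (length-map increasing F)))
      where
      F′ L : List (Fin N × Fin N)
      F′ = map increasing F
      L  = filter (_∈ₑ? F′) (edges G)

      deleted-< : ∀ {i j} → i Fin.< j → Adj G i j → In F i j → (i , j) ∈ L
      deleted-< i<j ij i∈ = ∈-filter⁺ (_∈ₑ? F′)
        (∈-filter⁺ _ (∈-cartesianProduct⁺ (∈-allFin _) (∈-allFin _)) (i<j , ij))
        (case i∈ of λ where
          (inj₁ p) → subst (_∈ F′) (proj₁ (increasing-< i<j)) (∈-map⁺ increasing p)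
          (inj₂ p) → subst (_∈ F′) (proj₂ (increasing-< i<j)) (∈-map⁺ increasing p))

      deleted : ∀ {i j} → Adj (G − L) i j → ¬ In F i j
      deleted {i} {j} (ij , p , q) i∈ with Fin.<-cmp i j
      ... | tri< i<j _ _ = p (deleted-< i<j ij i∈)
      ... | tri≈ _ i≡j _ = adj-≢ ij i≡j
      ... | tri> _ _ j<i = q (deleted-< j<i (symm G ij) (⊎-swap i∈))

      free : TriangleFree (G − L)
      free i j k (ij , ik , jk) = case h i j k (proj₁ ij , proj₁ ik , proj₁ jk) of λ where
        (inj₁ e)        → deleted ij e
        (inj₂ (inj₁ e)) → deleted ik e
        (inj₂ (inj₂ e)) → deleted jk e

    -- Carries a deleted edge from the vertex order of a face to that of the triangle in G.
    In-Hit : ∀ {F i j k} {x y : Fin N} → x ≢ y → x ∈₃ (i , j , k) → y ∈₃ (i , j , k) → In F x y → Hit F i j k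
    In-Hit x≢y 1st 1st e = ⊥-elim (x≢y refl)
    In-Hit x≢y 1st 2nd e = inj₁ e
    In-Hit x≢y 1st 3rd e = inj₂ (inj₁ e)
    In-Hit x≢y 2nd 1st e = inj₁ (⊎-swap e)
    In-Hit x≢y 2nd 2nd e = ⊥-elim (x≢y refl)
    In-Hit x≢y 2nd 3rd e = inj₂ (inj₂ e)
    In-Hit x≢y 3rd 1st e = inj₂ (inj₁ (⊎-swap e))
    In-Hit x≢y 3rd 2nd e = inj₂ (inj₂ (⊎-swap e))
    In-Hit x≢y 3rd 3rd e = ⊥-elim (x≢y refl)

    3tree-bound : Is3Tree G → 5 * τ G ≤ 9 * ν G + 1
    3tree-bound tree =
      let t , k , 5t≤9k+1 , p , cost F F≤t q = root-bound abc forest in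
      -- Covering starts from no deleted edges, hence the trailing empty list.
      ≤-trans (*-monoʳ-≤ 5 (≤-trans (τ-bound (F ++ []) (hit q))
        (≤-trans (≤-reflexive (cong length (++-identityʳ F))) F≤t)))
      (≤-trans 5t≤9k+1 (+-monoˡ-≤ 1 (*-monoʳ-≤ 9 (ν-bound once p))))
      where
      open Grown (grow-3tree tree)
      hit : ∀ {F} → Covers forest F → ∀ i j k → IsTriangle G (i , j , k) → Hit F i j k
      hit q i j k t@(ij , ik , jk) =
        let x , y , z , φ , i∈ , j∈ , k∈ = exhaustive i j k t
            xy , xz , yz = face-triangle abc φ
            x∈ , y∈ , z∈ = onto (adj-≢ ij) (adj-≢ ik) (adj-≢ jk) i∈ j∈ k∈
        in case covers-face q φ of λ where
          (inj₁ e)        → In-Hit (adj-≢ xy) x∈ y∈ e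
          (inj₂ (inj₁ e)) → In-Hit (adj-≢ xz) x∈ z∈ e
          (inj₂ (inj₂ e)) → In-Hit (adj-≢ yz) y∈ z∈ e

-- The rational form of the bound.

import Data.Nat.Properties as ℕ
open import Data.Integer.Base as ℤ using (+_)
import Data.Integer.Properties as ℤ
open import Data.Rational.Base using (_/_; _+_; _*_; _≤_; toℚᵘ)
import Data.Rational.Properties as ℚ
import Data.Rational.Unnormalised.Base as ℚᵘ
import Data.Rational.Unnormalised.Properties as ℚᵘ

fraction-bound : ∀ t v → 5 ℕ.* t ℕ.≤ 9 ℕ.* v ℕ.+ 1 → + t / 1 ≤ (+ 9 / 5) * (+ v / 1) + (+ 1 / 5)
fraction-bound t v h = ℚ.toℚᵘ-cancel-≤ (begin
  toℚᵘ (+ t / 1)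
    ≃⟨ ℚ.toℚᵘ-fromℚᵘ (+ t ℚᵘ./ 1) ⟩
  + t ℚᵘ./ 1
    ≤⟨ ℚᵘ.*≤* cross ⟩
  toℚᵘ (+ 9 / 5) ℚᵘ.* (+ v ℚᵘ./ 1) ℚᵘ.+ toℚᵘ (+ 1 / 5)
    ≃⟨ ℚᵘ.+-congˡ (toℚᵘ (+ 1 / 5)) (ℚᵘ.*-congˡ {toℚᵘ (+ 9 / 5)} (ℚ.toℚᵘ-fromℚᵘ (+ v ℚᵘ./ 1))) ⟨
  toℚᵘ (+ 9 / 5) ℚᵘ.* toℚᵘ (+ v / 1) ℚᵘ.+ toℚᵘ (+ 1 / 5)
    ≃⟨ ℚᵘ.+-congˡ (toℚᵘ (+ 1 / 5)) (ℚ.toℚᵘ-homo-* (+ 9 / 5) (+ v / 1)) ⟨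
  toℚᵘ ((+ 9 / 5) * (+ v / 1)) ℚᵘ.+ toℚᵘ (+ 1 / 5)
    ≃⟨ ℚ.toℚᵘ-homo-+ ((+ 9 / 5) * (+ v / 1)) (+ 1 / 5) ⟨
  toℚᵘ ((+ 9 / 5) * (+ v / 1) + (+ 1 / 5)) ∎)
  where
  open ℚᵘ.≤-Reasoning
  cross : + t ℤ.* + 25 ℤ.≤ (+ 9 ℤ.* + v ℤ.* + 5 ℤ.+ + 1 ℤ.* + 5) ℤ.* + 1
  -- The unnormalised denominators are 1 and 25, so cross-multiplication gives five times `h`.
  cross = subst₂ ℤ._≤_ (ℤ.pos-* t 25) rhs (ℤ.+≤+ (ℕ.≤-trans (ℕ.≤-reflexive (left t)) (ℕ.*-monoˡ-≤ 5 h)))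
    where
    left : ∀ t → t ℕ.* 25 ≡ 5 ℕ.* t ℕ.* 5
    left = solve-∀
    right : ∀ v → (9 ℕ.* v ℕ.+ 1) ℕ.* 5 ≡ (9 ℕ.* v ℕ.* 5 ℕ.+ 5) ℕ.* 1
    right = solve-∀
    rhs : + ((9 ℕ.* v ℕ.+ 1) ℕ.* 5) ≡ (+ 9 ℤ.* + v ℤ.* + 5 ℤ.+ + 1 ℤ.* + 5) ℤ.* + 1
    rhs = trans (cong +_ (right v)) (trans (ℤ.pos-* (9 ℕ.* v ℕ.* 5 ℕ.+ 5) 1)
      (cong (λ x → (x ℤ.+ + 5) ℤ.* + 1) (trans (ℤ.pos-* (9 ℕ.* v) 5) (cong (ℤ._* + 5) (ℤ.pos-* 9 v)))))

theorem5p1 : ∀ (n : ℕ) (G : Graph n) → Is3Tree G →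
    + τ G / 1 ≤ (+ 9 / 5) * (+ ν G / 1) + (+ 1 / 5)
theorem5p1 n G tree = fraction-bound (τ G) (ν G) (TreeBound.Parameters.3tree-bound G tree)
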